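{- Let $n\ge 2$ and $1\le k\le n-1$ be integers, let $\Delta_{k,n}=\{x\in[0,1]^n : \sum_{i=1}^n x_i=k\}$ be the hypersimplex, and let $\mathrm{ehr}(\Delta_{k,n},t)$ be its Ehrhart polynomial. Then for every integer $0\le m\le n-1$, the coefficient of $t^m$ in $(n-1)!\,\mathrm{ehr}(\Delta_{k,n},t)$ equals the number of $(1,\dots,1)$-compatible cycle-ordered, weighted permutations $(\sigma,p,w)$ of type $(n,m+1,k)$.
   Context: For a polytope $P\subset\mathbb{R}^n$ with integral vertices, $\mathrm{ehr}(P,t)$ is the polynomial in $t$ with $\mathrm{ehr}(P,t)=\#(tP\cap\mathbb{Z}^n)$ for all positive integers $t$. For a permutation $\sigma$, $C(\sigma)$ denotes the set of cycles in its cycle decomposition (fixed points count as cycles of length 1). For a permutation $p=[p_1,\dots,p_r]$ of $[r]=\{1,\dots,r\}$ in one-line notation, $\mathrm{Des}(p)=\{1\le i\le r-1 : p_i>p_{i+1}\}$ and $\mathrm{des}(p)=|\mathrm{Des}(p)|$. A cycle-ordered, weighted permutation of $[n]$ is a triple $(\sigma,p,w)$ where $\sigma$ is a permutation of $[n]$; $p$ is a permutation of $[r]$ with $p(r)=1$, where $r=|C(\sigma)|$; and $w:C(\sigma)\to\mathbb{N}_0=\{0,1,2,\dots\}$ is a function. The value $w(\mathfrak{c})$ is called the weight of the cycle $\mathfrak{c}$, and the total weight is $w(\sigma)=\sum_{\mathfrak{c}\in C(\sigma)}w(\mathfrak{c})$. The triple $(\sigma,p,w)$ is of type $(n,r,k)$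 if $|C(\sigma)|=r$ and $k=w(\sigma)+\mathrm{des}(p)$. For a tuple $\mathbf{c}=(c_1,\dots,c_n)$ of positive integers, $(\sigma,p,w)$ is $\mathbf{c}$-compatible if $w(\mathfrak{c})<\sum_{i\in\mathfrak{c}}c_i$ for all $\mathfrak{c}\in C(\sigma)$. In particular, $(1,\dots,1)$-compatible means that the weight of each cycle is strictly less than its length. -}

module Defs where

import Data.Bool.Properties as Bool
open import Data.Fin.Base as Fin using (Fin; toℕ)
import Data.Fin.Properties as Fin
open import Data.Fin.Subset using (Subset; ⁅_⁆; ⋃; ∣_∣)
open import Data.Fin.Subset.Properties using (_∈?_)
open import Data.Integer.Base as ℤ using (ℤ; +_)
open import Data.List.Base as List using (List; []; _∷_; length)
open import Data.List.Membership.Propositional using (_∈_)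
open import Data.List.Relation.Unary.Unique.Propositional using (Unique)
open import Data.Nat.Base as ℕ using (ℕ; zero; suc; NonZero)
import Data.Nat.ListAction as ℕ using (sum)
import Data.Nat.Properties as ℕ
open import Data.Product.Base using (∃-syntax; _×_)
open import Data.Rational.Base as ℚ using (ℚ; 0ℚ; 1ℚ; _/_)
open import Data.Vec.Base as Vec using (Vec)
import Data.Vec.Properties as Vec
open import Data.Vec.Relation.Unary.All using (All)
import Data.Vec.Relation.Unary.Unique.Propositional as VecUnique
open import Function.Bundles using (_⇔_)
open import Level using (0ℓ; _⊔_)
open import Relation.Binary.PropositionalEquality using (_≡_)
open import Relation.Nullary.Decidable using (Dec; does; _×-dec_)
open import Relation.Unary using (Pred)

HasCardinality : ∀ {a ℓ} {A : Set a} → Pred A ℓ → ℕ → Set (a ⊔ ℓ)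
HasCardinality P N =
  ∃[ xs ] Unique xs × (∀ x → x ∈ xs ⇔ P x) × length xs ≡ N

fromℤ : ℤ → ℚ
fromℤ z = z / 1

fromℕ : ℕ → ℚ
fromℕ m = fromℤ (+ m)

------------------------------------------------------------------------
-- Polynomials, as coefficient lists with the constant term first;
-- trailing zeros are allowed.

Polynomial : Set
Polynomial = List ℚ

coeff : Polynomial → ℕ → ℚ
coeff []       m       = 0ℚ
coeff (a ∷ as) zero    = a
coeff (a ∷ as) (suc m) = coeff as m

eval : Polynomial → ℚ → ℚ
eval []       t = 0ℚ
eval (a ∷ as) t = a ℚ.+ t ℚ.* eval as t

infixr 7 _·_

_·_ : ℚ → Polynomial → Polynomial
q · f = List.map (q ℚ.*_) f

------------------------------------------------------------------------
-- Lattice points.  A subset of ℝⁿ is represented by its set of rational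
-- points.  This does not change tP ∩ ℤⁿ for a positive integer t: if
-- z = t x is integral then x = z / t is rational.

Point : ℕ → Set
Point n = Vec ℚ n

dilate : ∀ {n} → ℚ → Pred (Point n) 0ℓ → Pred (Point n) 0ℓ
dilate t P y = ∃[ x ] P x × y ≡ Vec.map (t ℚ.*_) x

LatticePoint : ∀ {n} → Pred (Point n) 0ℓ → Pred (Vec ℤ n) 0ℓ
LatticePoint P z = P (Vec.map fromℤ z)

IsEhrhartPolynomial : ∀ {n} → Pred (Point n) 0ℓ → Polynomial → Set
IsEhrhartPolynomial P f =
  ∀ (t : ℕ) .{{_ : NonZero t}} →
  ∃[ N ] HasCardinality (LatticePoint (dilate (fromℕ t) P)) N
         × eval f (fromℕ t) ≡ fromℕ N

Hypersimplex : ℕ → (n : ℕ) → Pred (Point n) 0ℓ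
Hypersimplex k n x =
  All (λ xᵢ → 0ℚ ℚ.≤ xᵢ × xᵢ ℚ.≤ 1ℚ) x × Vec.foldr′ ℚ._+_ 0ℚ x ≡ fromℕ k

------------------------------------------------------------------------
-- Permutations of [r] are given in one-line notation, as vectors in
-- Vec (Fin r) r with distinct entries, so that propositional equality is
-- the intended equality when they are counted (Data.Fin.Permutation is
-- function-based).  The element i of [r] is the i-1 of Fin r.

-- n iterates suffice, as no cycle is longer than n.
orbit : ∀ {n} → Vec (Fin n) n → Fin n → Subset n
orbit {n} σ i = ⋃ (List.map ⁅_⁆ (List.iterate (Vec.lookup σ) i n))

-- The cycles of σ, each given by its support and listed exactly once.
cycles : ∀ {n} → Vec (Fin n) n → List (Subset n)
cycles {n} σ =
  List.deduplicate (Vec.≡-dec Bool._≟_) (List.map (orbit σ) (List.allFin n))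

Descent : ∀ {r} → Vec (Fin r) r → Pred (Fin r) 0ℓ
Descent p i =
  ∃[ j ] toℕ j ≡ suc (toℕ i) × Vec.lookup p j Fin.< Vec.lookup p i

descent? : ∀ {r} (p : Vec (Fin r) r) i → Dec (Descent p i)
descent? p i = Fin.any? λ j →
  (toℕ j ℕ.≟ suc (toℕ i)) ×-dec (Vec.lookup p j Fin.<? Vec.lookup p i)

Des : ∀ {r} → Vec (Fin r) r → Subset r
Des p = Vec.tabulate λ i → does (descent? p i)

des : ∀ {r} → Vec (Fin r) r → ℕ
des p = ∣ Des p ∣

-- The j-th entry of w is the weight of the j-th entry of cycles σ.  The
-- proofs are irrelevant so that equality only concerns the data.
record CycleOrderedWeightedPermutation (n : ℕ) : Set where
  constructor mk
  field
    σ : Vec (Fin n) n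

  r : ℕ
  r = length (cycles σ)

  field
    p         : Vec (Fin r) r
    w         : Vec ℕ r
    .σ-unique : VecUnique.Unique σ
    .p-unique : VecUnique.Unique p
    .p-last   : ∀ i → suc (toℕ i) ≡ r → toℕ (Vec.lookup p i) ≡ 0

  cycle : Fin r → Subset n
  cycle = List.lookup (cycles σ)

  totalWeight : ℕ
  totalWeight = Vec.sum w

open CycleOrderedWeightedPermutation

HasType : ∀ (n r k : ℕ) → Pred (CycleOrderedWeightedPermutation n) 0ℓ
HasType n r′ k x = r x ≡ r′ × k ≡ totalWeight x ℕ.+ des (p x)

sumOver : ∀ {n} → Subset n → Vec ℕ n → ℕ
sumOver {n} S c =
  ℕ.sum (List.map (Vec.lookup c) (List.filter (_∈? S) (List.allFin n)))

Compatible : ∀ {n} → Vec ℕ n → Pred (CycleOrderedWeightedPermutation n) 0ℓ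
Compatible c x = ∀ j → Vec.lookup (w x) j ℕ.< sumOver (cycle x j) c

{-# OPTIONS --safe #-}
module Submission where

open import Defs
open import Data.Bool.Base as Bool using (Bool; true; false; if_then_else_; _∧_)
import Data.Bool.Properties as Bool
open import Data.Fin.Base as Fin using (Fin; zero; suc; toℕ; punchIn; punchOut)
import Data.Fin.Properties as Fin
open import Data.Fin.Subset as Subset
  using (∣_∣; Subset; ⋃; ⁅_⁆; inside; outside; ⊥) renaming (_∈_ to _∈ˢ_)
open import Data.Fin.Subset.Properties as Subset using (_∈?_)
open import Data.Integer.Base as ℤ using (ℤ; +_; 0ℤ; 1ℤ; +≤+; _+_; _*_; _-_; -_; _^_)
import Data.Integer.Properties as ℤ
open import Data.Integer.Tactic.RingSolver using (solve-∀)
open import Data.List.Base as List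
  using (List; []; _∷_; _++_; concatMap; upTo; allFin; filter; length; applyUpTo)
open import Data.List.Membership.Propositional using (_∈_)
open import Data.List.Membership.Propositional.Properties
open import Data.List.Membership.Propositional.Properties.WithK using (unique∧set⇒bag)
import Data.List.Properties as List
open import Data.List.Relation.Binary.BagAndSetEquality using (∼bag⇒↭)
open import Data.List.Relation.Binary.Permutation.Propositional as Permutation
  using (_↭_; ↭-trans; ↭-reflexive)
import Data.List.Relation.Binary.Permutation.Propositional.Properties as Perm
open import Data.List.Relation.Unary.All as All using (All; []; _∷_)
open import Data.List.Relation.Unary.AllPairs using (AllPairs; []; _∷_)
open import Data.List.Relation.Unary.Any using (here; there)
open import Data.List.Relation.Unary.Unique.Propositional using (Unique)
import Data.List.Relation.Unary.Unique.DecPropositional.Properties as DecUnique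
import Data.List.Relation.Unary.Unique.Propositional.Properties as Unique
open import Data.Nat.Base as ℕ
  using (ℕ; zero; suc; pred; _≤_; _<_; z≤n; s≤s; _∸_; _<ᵇ_; _≡ᵇ_; _!)
open import Data.Nat.DivMod using (_%_; _/_; m≡m%n+[m/n]*n; m%n<n)
open import Data.Nat.GeneralisedArithmetic using (iterate)
import Data.Nat.ListAction as ℕ
import Data.Nat.Properties as ℕ
import Data.Nat.Tactic.RingSolver as ℕSolver
open import Data.Product.Base using (∃-syntax; Σ; _×_; _,_; proj₁; proj₂)
open import Data.Rational.Base as ℚ using (ℚ; 0ℚ; 1ℚ; toℚᵘ; 1/_; NonZero; ≢-nonZero)
import Data.Rational.Properties as ℚ
open import Data.Rational.Solver using (module +-*-Solver)
open import Data.Rational.Unnormalised.Base as ℚᵘ using (mkℚᵘ; *≡*; *≤*)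
import Data.Rational.Unnormalised.Properties as ℚᵘ
open import Data.Sum.Base using (inj₁; inj₂; [_,_]′)
open import Data.Vec.Base as Vec using (Vec; []; _∷_; head; lookup; replicate)
import Data.Vec.Properties as Vec
open import Data.Vec.Relation.Unary.All as VecAll using ([]; _∷_)
import Data.Vec.Relation.Unary.All.Properties as VecAll
open import Data.Vec.Relation.Unary.AllPairs using (allPairs?)
open import Data.Vec.Relation.Unary.Unique.Propositional as VecUnique using ([]; _∷_)
import Data.Vec.Relation.Unary.Unique.Propositional.Properties as VecUnique
open import Function.Base using (_∘_; id)
open import Function.Bundles using (_⇔_; mk⇔; Equivalence)
open import Function.Construct.Composition using (_⇔-∘_)
open import Function.Construct.Symmetry using (⇔-sym)
open import Level using (0ℓ)
open import Relation.Binary.PropositionalEquality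
open import Relation.Nullary.Decidable
  using (Dec; does; yes; no; does-⇔; _×-dec_; ¬?; recompute)
open import Relation.Nullary.Negation using (contradiction; ¬_)
open import Relation.Unary using (Pred; Decidable; _∩_; U)

open ≡-Reasoning
open Equivalence using (to; from)
open +-*-Solver using (solve; _:+_; _:*_; _:-_; :-_; _:=_; con)

-- A vector w with 0 ≤ wᵢ < ℓᵢ contributes to ∏ᵢ (1 - z^ℓᵢ) / (1 - z), and
-- Worpitzky's identity gives Σ_p z^des(p) = (1 - z)^r Σ_a a^(r-1) z^a for the
-- orders p of r cycles.  So a permutation σ with r cycles underlies
-- [z^k] ∏_c (1 - z^|c|) Σ_a a^(r-1) z^a triples.  Multiplying this by t^(r-1)
-- and building σ by inserting one element at a time yields the sum over σ
--   Σ_{j ≤ k} (-1)^j C(n,j) ∏_{i=1}^{n-1} ((k - j) t - j + i),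
-- which is (n - 1)! times the inclusion-exclusion count of the lattice points
-- of t Δ_{k,n}.  Hence the two polynomials agree at every positive integer t,
-- and therefore have the same coefficients.
--
-- A power series in z is handled through the sequence of its coefficients,
-- read downwards from z^k: multiplication by z is the shift S of sequences.

-- Both sides become values at t of one explicit sum, the counts being the coefficients of a
-- polynomial in t. Fix σ with r cycles. Its weights contribute ∏_c (1 - z^|c|) / (1 - z), and its
-- orders contribute Worpitzky's (1 - z)^r Σ_a a^(r-1) z^a (`∑-lastZero`). The powers of 1 - z
-- cancel (`∑-labels`), so no power series is ever inverted.
--
-- To sum over σ, expand ∏_c (1 - z^|c|) over sets of coloured cycles, and let the coloured cycles
-- cover j of the n elements. With x = (k - j) t, the permutations of the j coloured elements, with
-- -x per cycle, sum to (-1)^j x (x - 1) ⋯ (x - j + 1). Those of the n - j others, with x per cycle,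
-- sum to x (x + 1) ⋯ (x + n - j - 1). The exponent is r - 1 rather than r, which removes one factor
-- x. What is left is (-1)^j times the product of the n - 1 consecutive factors x - j + i, 1 ≤ i ≤ n
-- - 1. `∑-perms` proves this by induction on n: inserting one more element (`∑-insert`) changes the
-- sum exactly as `D-risinging-step` predicts.
--
-- The lattice points of the dilate are the w in {0, ..., t}^n with sum k t, hence counted by the
-- coefficient of z^(k t) in ((1 - z^(t+1)) / (1 - z))^n. As (n - 1)! / (1 - z)^n = Σ_a (a + 1) ⋯ (a
-- + n - 1) z^a (`D-risinging`), inclusion-exclusion gives the same summands, because k t - j (t +
-- 1) = (k - j) t - j (`∑-box-δ₀`). The ranges j (t + 1) ≤ k t and j ≤ k differ only in terms that
-- vanish (`at-rising-dilate`).
--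
-- Thus `∑-count` equates the two sides at each t, and a polynomial is determined by its values at
-- the positive integers (`eval-injective`).

private variable
  A B C : Set

-- Finite sums and difference operators

+-congˡ : ∀ a {b c : ℤ} → b ≡ c → a + b ≡ a + c
+-congˡ a = cong (λ b → a + b)

∑ : List A → (A → ℤ) → ℤ
∑ []       f = 0ℤ
∑ (x ∷ xs) f = f x + ∑ xs f

infixr 8 ∑
syntax ∑ xs (λ x → e) = ∑[ x ← xs ] e

∑-cong-∈ : ∀ (xs : List A) {f g : A → ℤ} → (∀ {x} → x ∈ xs → f x ≡ g x) → ∑ xs f ≡ ∑ xs g
∑-cong-∈ []       f≡g = refl
∑-cong-∈ (x ∷ xs) f≡g = cong₂ _+_ (f≡g (here refl)) (∑-cong-∈ xs (f≡g ∘ there))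

∑-cong : ∀ (xs : List A) {f g : A → ℤ} → (∀ x → f x ≡ g x) → ∑ xs f ≡ ∑ xs g
∑-cong xs f≡g = ∑-cong-∈ xs (λ {x} _ → f≡g x)

∑-0 : ∀ (xs : List A) → ∑[ x ← xs ] 0ℤ ≡ 0ℤ
∑-0 []       = refl
∑-0 (x ∷ xs) = trans (ℤ.+-identityˡ _) (∑-0 xs)

interchange : ∀ a b c d → (a + b) + (c + d) ≡ (a + c) + (b + d)
interchange = solve-∀

∑-+ : ∀ (xs : List A) (f g : A → ℤ) → ∑[ x ← xs ] (f x + g x) ≡ ∑ xs f + ∑ xs g
∑-+ []       f g = refl
∑-+ (x ∷ xs) f g = trans (+-congˡ (f x + g x) (∑-+ xs f g)) (interchange (f x) (g x) _ _)

∑-*ˡ : ∀ (xs : List A) c (f : A → ℤ) → ∑[ x ← xs ] (c * f x) ≡ c * ∑ xs f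
∑-*ˡ []       c f = sym (ℤ.*-zeroʳ c)
∑-*ˡ (x ∷ xs) c f = trans (+-congˡ (c * f x) (∑-*ˡ xs c f)) (sym (ℤ.*-distribˡ-+ c (f x) _))

∑-neg : ∀ (xs : List A) (f : A → ℤ) → ∑[ x ← xs ] (- f x) ≡ - ∑ xs f
∑-neg []       f = refl
∑-neg (x ∷ xs) f = trans (+-congˡ (- f x) (∑-neg xs f)) (sym (ℤ.neg-distrib-+ (f x) _))

∑-- : ∀ (xs : List A) (f g : A → ℤ) → ∑[ x ← xs ] (f x - g x) ≡ ∑ xs f - ∑ xs g
∑-- xs f g = trans (∑-+ xs f (λ x → - g x)) (+-congˡ (∑ xs f) (∑-neg xs g))

∑-++ : ∀ (xs ys : List A) (f : A → ℤ) → ∑ (xs ++ ys) f ≡ ∑ xs f + ∑ ys f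
∑-++ []       ys f = sym (ℤ.+-identityˡ _)
∑-++ (x ∷ xs) ys f = trans (+-congˡ (f x) (∑-++ xs ys f)) (sym (ℤ.+-assoc (f x) _ _))

∑-map : ∀ (h : A → B) (xs : List A) (f : B → ℤ) → ∑ (List.map h xs) f ≡ ∑ xs (f ∘ h)
∑-map h []       f = refl
∑-map h (x ∷ xs) f = +-congˡ (f (h x)) (∑-map h xs f)

∑-swap : ∀ (xs : List A) (ys : List B) (f : A → B → ℤ) →
         ∑[ x ← xs ] ∑[ y ← ys ] f x y ≡ ∑[ y ← ys ] ∑[ x ← xs ] f x y
∑-swap []       ys f = sym (∑-0 ys)
∑-swap (x ∷ xs) ys f =
  trans (+-congˡ (∑ ys (f x)) (∑-swap xs ys f)) (sym (∑-+ ys (f x) _))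

∑-length : ∀ (xs : List A) → ∑[ _ ← xs ] 1ℤ ≡ + length xs
∑-length []       = refl
∑-length (x ∷ xs) = +-congˡ 1ℤ (∑-length xs)

bind : {B : A → Set} → (∀ x → B x → C) → List A → (∀ x → List (B x)) → List C
bind h xs ys = concatMap (λ x → List.map (h x) (ys x)) xs

∑-bind : ∀ {B : A → Set} (h : ∀ x → B x → C) xs ys (f : C → ℤ) →
         ∑ (bind h xs ys) f ≡ ∑[ x ← xs ] ∑[ y ← ys x ] f (h x y)
∑-bind h []       ys f = refl
∑-bind h (x ∷ xs) ys f = trans (∑-++ (List.map (h x) (ys x)) _ f)
  (cong₂ _+_ (∑-map (h x) (ys x) f) (∑-bind h xs ys f))

∑-upTo : ∀ n (f : ℕ → ℤ) → ∑ (upTo (suc n)) f ≡ f 0 + ∑ (upTo n) (f ∘ suc)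
∑-upTo n f = +-congˡ (f 0)
  (trans (cong (λ xs → ∑ xs f) (sym (List.map-applyUpTo id suc n))) (∑-map suc (upTo n) f))

∑-telescope : ∀ n (f : ℕ → ℤ) → ∑[ i ← upTo n ] (f i - f (suc i)) ≡ f 0 - f n
∑-telescope zero    f = sym (ℤ.+-inverseʳ (f 0))
∑-telescope (suc n) f = begin
  ∑[ i ← upTo (suc n) ] (f i - f (suc i))          ≡⟨ ∑-upTo n (λ i → f i - f (suc i)) ⟩
  (f 0 - f 1) + (∑[ i ← upTo n ] (f (suc i) - f (suc (suc i)))) ≡⟨ +-congˡ (f 0 - f 1) (∑-telescope n (f ∘ suc)) ⟩
  (f 0 - f 1) + (f 1 - f (suc n))                  ≡⟨ lemma (f 0) (f 1) _ ⟩
  f 0 - f (suc n)                                  ∎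
  where
  lemma : ∀ a b c → (a - b) + (b - c) ≡ a - c
  lemma = solve-∀

-- ((1 - S)^n f) 0, where (S f) j = f (1 + j).
D : ℕ → (ℕ → ℤ) → ℤ
D zero    f = f 0
D (suc n) f = D n (λ j → f j - f (suc j))

D-cong : ∀ n {f g : ℕ → ℤ} → (∀ j → f j ≡ g j) → D n f ≡ D n g
D-cong zero    f≡g = f≡g 0
D-cong (suc n) f≡g = D-cong n (λ j → cong₂ _-_ (f≡g j) (f≡g (suc j)))

+-distrib-- : ∀ a b c d → (a + b) - (c + d) ≡ (a - c) + (b - d)
+-distrib-- = solve-∀

D-+ : ∀ n (f g : ℕ → ℤ) → D n (λ j → f j + g j) ≡ D n f + D n g
D-+ zero    f g = refl
D-+ (suc n) f g = trans (D-cong n (λ j → +-distrib-- (f j) (g j) _ _)) (D-+ n _ _)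

*-distribˡ-- : ∀ c a b → c * a - c * b ≡ c * (a - b)
*-distribˡ-- = solve-∀

D-*ˡ : ∀ n c (f : ℕ → ℤ) → D n (λ j → c * f j) ≡ c * D n f
D-*ˡ zero    c f = refl
D-*ˡ (suc n) c f = trans (D-cong n (λ j → *-distribˡ-- c (f j) _)) (D-*ˡ n c _)

D-0 : ∀ n → D n (λ _ → 0ℤ) ≡ 0ℤ
D-0 zero    = refl
D-0 (suc n) = D-0 n

D-∑ : ∀ n (xs : List A) (f : A → ℕ → ℤ) →
      D n (λ j → ∑[ x ← xs ] f x j) ≡ ∑[ x ← xs ] D n (f x)
D-∑ n []       f = D-0 n
D-∑ n (x ∷ xs) f = trans (D-+ n (f x) _) (+-congˡ (D n (f x)) (D-∑ n xs f))

-- (∏ (1 - S^ℓ) f) 0, the product being over the entries ℓ of L.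
Z : List ℕ → (ℕ → ℤ) → ℤ
Z []      f = f 0
Z (ℓ ∷ L) f = Z L (λ b → f b - f (ℓ ℕ.+ b))

Z-cong : ∀ L {f g : ℕ → ℤ} → (∀ b → f b ≡ g b) → Z L f ≡ Z L g
Z-cong []      f≡g = f≡g 0
Z-cong (ℓ ∷ L) f≡g = Z-cong L (λ b → cong₂ _-_ (f≡g b) (f≡g (ℓ ℕ.+ b)))

Z-+ : ∀ L (f g : ℕ → ℤ) → Z L (λ b → f b + g b) ≡ Z L f + Z L g
Z-+ []      f g = refl
Z-+ (ℓ ∷ L) f g = trans (Z-cong L (λ b → +-distrib-- (f b) (g b) _ _)) (Z-+ L _ _)

Z-*ˡ : ∀ L c (f : ℕ → ℤ) → Z L (λ b → c * f b) ≡ c * Z L f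
Z-*ˡ []      c f = refl
Z-*ˡ (ℓ ∷ L) c f = trans (Z-cong L (λ b → *-distribˡ-- c (f b) _)) (Z-*ˡ L c _)

Z-neg : ∀ L (f : ℕ → ℤ) → Z L (λ b → - f b) ≡ - Z L f
Z-neg L f = begin
  Z L (λ b → - f b)           ≡⟨ Z-cong L (λ b → sym (ℤ.-1*i≡-i (f b))) ⟩
  Z L (λ b → ℤ.-1ℤ * f b)     ≡⟨ Z-*ˡ L ℤ.-1ℤ f ⟩
  ℤ.-1ℤ * Z L f               ≡⟨ ℤ.-1*i≡-i _ ⟩
  - Z L f                     ∎

Z-- : ∀ L (f g : ℕ → ℤ) → Z L (λ b → f b - g b) ≡ Z L f - Z L g
Z-- L f g = trans (Z-+ L f (λ b → - g b)) (+-congˡ (Z L f) (Z-neg L g))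

Z-0 : ∀ L → Z L (λ _ → 0ℤ) ≡ 0ℤ
Z-0 []      = refl
Z-0 (ℓ ∷ L) = Z-0 L

Z-∑ : ∀ L (xs : List A) (f : A → ℕ → ℤ) →
      Z L (λ b → ∑[ x ← xs ] f x b) ≡ ∑[ x ← xs ] Z L (f x)
Z-∑ L []       f = Z-0 L
Z-∑ L (x ∷ xs) f = trans (Z-+ L (f x) _) (+-congˡ (Z L (f x)) (Z-∑ L xs f))

-- The operators 1 - S^ℓ commute. This matters because the cycles of a permutation are known only up
-- to order after an insertion.
Z-↭ : ∀ {L L′} → L ↭ L′ → ∀ f → Z L f ≡ Z L′ f
Z-↭ Permutation.refl             f = refl
Z-↭ (Permutation.prep ℓ L↭L′)    f = Z-↭ L↭L′ _
Z-↭ {x ∷ y ∷ L} (Permutation.swap ℓ ℓ′ L↭L′) f = trans (Z-cong L swapped) (Z-↭ L↭L′ _)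
  where
  lemma : ∀ a b c d → (a - b) - (c - d) ≡ (a - c) - (b - d)
  lemma = solve-∀

  swapped : ∀ b → (f b - f (ℓ ℕ.+ b)) - (f (ℓ′ ℕ.+ b) - f (ℓ ℕ.+ (ℓ′ ℕ.+ b))) ≡
                  (f b - f (ℓ′ ℕ.+ b)) - (f (ℓ ℕ.+ b) - f (ℓ′ ℕ.+ (ℓ ℕ.+ b)))
  swapped b = trans (lemma (f b) (f (ℓ ℕ.+ b)) (f (ℓ′ ℕ.+ b)) _)
    (cong (λ z → (f b - f (ℓ′ ℕ.+ b)) - (f (ℓ ℕ.+ b) - f z))
      (trans (sym (ℕ.+-assoc ℓ ℓ′ b)) (trans (cong (ℕ._+ b) (ℕ.+-comm ℓ ℓ′)) (ℕ.+-assoc ℓ′ ℓ b))))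
Z-↭ (Permutation.trans p q)      f = trans (Z-↭ p f) (Z-↭ q f)

Z-replicate : ∀ n ℓ f → Z (List.replicate n ℓ) f ≡ D n (λ j → f (j ℕ.* ℓ))
Z-replicate zero    ℓ f = refl
Z-replicate (suc n) ℓ f = Z-replicate n ℓ _

box : ∀ {r} → Vec ℕ r → List (Vec ℕ r)
box []      = [] ∷ []
box (ℓ ∷ L) = bind _∷_ (upTo ℓ) (λ _ → box L)

-- (1 - S) (1 + S + ⋯ + S^(ℓ-1)) = 1 - S^ℓ for the shift S.
∑-box : ∀ {r} (L : Vec ℕ r) (f : ℕ → ℤ) →
        ∑[ w ← box L ] D r (λ j → f (Vec.sum w ℕ.+ j)) ≡ Z (Vec.toList L) f
∑-box []            f = ℤ.+-identityʳ (f 0)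
∑-box {suc r} (ℓ ∷ L) f = begin
  ∑[ w ← box (ℓ ∷ L) ] D (suc r) (λ j → f (Vec.sum w ℕ.+ j))
    ≡⟨ ∑-bind _∷_ (upTo ℓ) (λ _ → box L) _ ⟩
  ∑[ x ← upTo ℓ ] ∑[ w ← box L ] D r (λ j → f (x ℕ.+ Vec.sum w ℕ.+ j) - f (x ℕ.+ Vec.sum w ℕ.+ suc j))
    ≡⟨ ∑-cong (upTo ℓ) (λ x → ∑-cong (box L) (λ w → D-cong r (λ j →
         cong₂ (λ y z → f y - f z) (ℕ.+-assoc x (Vec.sum w) j)
           (trans (ℕ.+-suc _ j) (cong suc (ℕ.+-assoc x (Vec.sum w) j)))))) ⟩
  ∑[ x ← upTo ℓ ] ∑[ w ← box L ] D r (λ j → g x (Vec.sum w ℕ.+ j))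
    ≡⟨ ∑-cong (upTo ℓ) (λ x → ∑-box L (g x)) ⟩
  ∑[ x ← upTo ℓ ] Z (Vec.toList L) (g x)
    ≡⟨ sym (Z-∑ (Vec.toList L) (upTo ℓ) g) ⟩
  Z (Vec.toList L) (λ b → ∑[ x ← upTo ℓ ] g x b)
    ≡⟨ Z-cong (Vec.toList L) (λ b → ∑-telescope ℓ (λ x → f (x ℕ.+ b))) ⟩
  Z (Vec.toList L) (λ b → f b - f (ℓ ℕ.+ b)) ∎
  where
  g : ℕ → ℕ → ℤ
  g x b = f (x ℕ.+ b) - f (suc x ℕ.+ b)

-- Rising factorials and truncated sequences

-- (x + 1) ⋯ (x + m)
rising : ℕ → ℤ → ℤ
rising zero    x = 1ℤ
rising (suc m) x = rising m x * (x + + suc m)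

rising-shift : ∀ m x → rising (suc m) x ≡ (x + 1ℤ) * rising m (x + 1ℤ)
rising-shift zero    x = lemma x
  where
  lemma : ∀ x → 1ℤ * (x + 1ℤ) ≡ (x + 1ℤ) * 1ℤ
  lemma = solve-∀
rising-shift (suc m) x = begin
  rising (suc m) x * (x + + suc (suc m))                   ≡⟨ cong₂ _*_ (rising-shift m x) (cong (λ y → x + y) (ℤ.pos-+ 1 (suc m))) ⟩
  (x + 1ℤ) * rising m (x + 1ℤ) * (x + (1ℤ + + suc m))       ≡⟨ lemma x (rising m (x + 1ℤ)) (+ suc m) ⟩
  (x + 1ℤ) * (rising m (x + 1ℤ) * (x + 1ℤ + + suc m))       ∎
  where
  lemma : ∀ x r s → (x + 1ℤ) * r * (x + (1ℤ + s)) ≡ (x + 1ℤ) * (r * (x + 1ℤ + s))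
  lemma = solve-∀

rising-vanishes : ∀ m d → d < m → rising m (- + suc d) ≡ 0ℤ
rising-vanishes (suc m) d (s≤s d≤m) with ℕ.m≤n⇒m<n∨m≡n d≤m
... | inj₁ d<m  = trans (cong (_* (- + suc d + + suc m)) (rising-vanishes m d d<m)) (ℤ.*-zeroˡ (- + suc d + + suc m))
... | inj₂ refl = trans (cong (rising m (- + suc m) *_) (ℤ.+-inverseˡ (+ suc m))) (ℤ.*-zeroʳ (rising m (- + suc m)))

-- g (k - b), cut off to 0 for b > k.
at : (ℕ → ℤ) → ℕ → ℕ → ℤ
at g k       zero    = g k
at g zero    (suc b) = 0ℤ
at g (suc k) (suc b) = at g k b

at-cong : ∀ {g h : ℕ → ℤ} → (∀ a → g a ≡ h a) → ∀ k b → at g k b ≡ at h k b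
at-cong g≡h k       zero    = g≡h k
at-cong g≡h zero    (suc b) = refl
at-cong g≡h (suc k) (suc b) = at-cong g≡h k b

at-*ˡ : ∀ c (g : ℕ → ℤ) k b → at (λ a → c * g a) k b ≡ c * at g k b
at-*ˡ c g k       zero    = refl
at-*ˡ c g zero    (suc b) = sym (ℤ.*-zeroʳ c)
at-*ˡ c g (suc k) (suc b) = at-*ˡ c g k b

at-- : ∀ (g h : ℕ → ℤ) k b → at (λ a → g a - h a) k b ≡ at g k b - at h k b
at-- g h k       zero    = refl
at-- g h zero    (suc b) = refl
at-- g h (suc k) (suc b) = at-- g h k b

at-+ : ∀ g b a → at g (b ℕ.+ a) b ≡ g a
at-+ g zero    a = refl
at-+ g (suc b) a = at-+ g b a

at-> : ∀ g k b → k < b → at g k b ≡ 0ℤ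
at-> g zero    (suc b) _         = refl
at-> g (suc k) (suc b) (s≤s k<b) = at-> g k b k<b

shift : (ℕ → ℤ) → ℕ → ℤ
shift g zero    = 0ℤ
shift g (suc a) = g a

-- Links the two meanings of multiplication by z: the shift S in the position `b`, and `shift` on
-- the coefficients themselves. Differences in `b` thereby become `∇` of the coefficient sequence.
at-shift : ∀ g k b → at g k (suc b) ≡ at (shift g) k b
at-shift g zero    zero    = refl
at-shift g (suc k) zero    = refl
at-shift g zero    (suc b) = refl
at-shift g (suc k) (suc b) = at-shift g k b

∇ : (ℕ → ℤ) → ℕ → ℤ
∇ g a = g a - shift g a

at-∇ : ∀ g k b → at g k b - at g k (suc b) ≡ at (∇ g) k b
at-∇ g k b = trans (cong (λ x → at g k b - x) (at-shift g k b)) (sym (at-- g (shift g) k b))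

δ₀ : ℕ → ℤ
δ₀ zero    = 1ℤ
δ₀ (suc _) = 0ℤ

∇-1 : ∀ a → ∇ (λ _ → 1ℤ) a ≡ δ₀ a
∇-1 zero    = refl
∇-1 (suc a) = refl

-- The discrete derivative of a factorial power: the products at a and a - 1 share the factors a +
-- 1, ..., a + m. At 0 the value 0 supplied by `shift` is the true one, since -1 is a root.
∇-risinging : ∀ m a → ∇ (λ a → rising (suc m) (+ a)) a ≡ + suc m * rising m (+ a)
∇-risinging m zero    = lemma (rising m 0ℤ) (+ suc m)
  where
  lemma : ∀ r s → r * (0ℤ + s) - 0ℤ ≡ s * r
  lemma = solve-∀
∇-risinging m (suc a) = begin
  rising m (+ suc a) * (+ suc a + + suc m) - rising (suc m) (+ a)
    ≡⟨ cong (λ y → rising m (+ suc a) * (+ suc a + + suc m) - y) (rising-shift m (+ a)) ⟩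
  rising m (+ suc a) * (+ suc a + + suc m) - (+ a + 1ℤ) * rising m (+ a + 1ℤ)
    ≡⟨ cong (λ y → rising m (+ suc a) * (+ suc a + + suc m) - y * rising m y) (ℤ.+-comm (+ a) 1ℤ) ⟩
  rising m (+ suc a) * (+ suc a + + suc m) - + suc a * rising m (+ suc a)
    ≡⟨ lemma (rising m (+ suc a)) (+ suc a) (+ suc m) ⟩
  + suc m * rising m (+ suc a) ∎
  where
  lemma : ∀ r x s → r * (x + s) - x * r ≡ s * r
  lemma = solve-∀

D-suc-at : ∀ n g k b →
           D (suc n) (λ j → at g k (b ℕ.+ j)) ≡ D n (λ j → at (∇ g) k (b ℕ.+ j))
D-suc-at n g k b = D-cong n λ j →
  trans (cong (λ c → at g k (b ℕ.+ j) - at g k c) (ℕ.+-suc b j)) (at-∇ g k (b ℕ.+ j))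

D-1 : ∀ k b → D 1 (λ j → at (λ _ → 1ℤ) k (b ℕ.+ j)) ≡ at δ₀ k b
D-1 k b = trans (D-suc-at 0 (λ _ → 1ℤ) k b)
  (trans (cong (at _ k) (ℕ.+-identityʳ b)) (at-cong ∇-1 k b))

-- The binomial series (1 - z)^(m+1) Σ_a (a + 1) ⋯ (a + m) z^a = m!, multiplied by z^b and read at
-- z^s. Each factor 1 - z lowers m by one through `∇-risinging`.
D-risinging : ∀ m s b → D (suc m) (λ j → at (λ a → rising m (+ a)) s (b ℕ.+ j)) ≡ + (m !) * at δ₀ s b
D-risinging zero    s b = trans (D-1 s b) (sym (ℤ.*-identityˡ _))
D-risinging (suc m) s b = begin
  D (suc (suc m)) (λ j → at (λ a → rising (suc m) (+ a)) s (b ℕ.+ j))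
    ≡⟨ D-suc-at (suc m) _ s b ⟩
  D (suc m) (λ j → at (∇ (λ a → rising (suc m) (+ a))) s (b ℕ.+ j))
    ≡⟨ D-cong (suc m) (λ j → trans (at-cong (∇-risinging m) s (b ℕ.+ j)) (at-*ˡ (+ suc m) _ s (b ℕ.+ j))) ⟩
  D (suc m) (λ j → + suc m * at (λ a → rising m (+ a)) s (b ℕ.+ j))
    ≡⟨ D-*ˡ (suc m) (+ suc m) (λ j → at (λ a → rising m (+ a)) s (b ℕ.+ j)) ⟩
  + suc m * D (suc m) (λ j → at (λ a → rising m (+ a)) s (b ℕ.+ j))
    ≡⟨ cong (+ suc m *_) (D-risinging m s b) ⟩
  + suc m * (+ (m !) * at δ₀ s b)
    ≡⟨ sym (ℤ.*-assoc (+ suc m) (+ (m !)) _) ⟩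
  + suc m * + (m !) * at δ₀ s b
    ≡⟨ cong (_* at δ₀ s b) (sym (ℤ.pos-* (suc m) (m !))) ⟩
  + (suc m !) * at δ₀ s b ∎

-- Lattice points by inclusion-exclusion

private
  at-rising-dilate-+ : ∀ m t j a → j ℕ.+ a ≤ m →
                    at (λ a → rising m (+ a)) ((j ℕ.+ a) ℕ.* t) (j ℕ.* suc t) ≡
                    at (λ a → rising m (+ (a ℕ.* t) - + j)) (j ℕ.+ a) j
  at-rising-dilate-+ m t j a j+a≤m with ℕ.≤-<-connex j (a ℕ.* t)
  ... | inj₁ j≤at = begin
    at risingℕ ((j ℕ.+ a) ℕ.* t) (j ℕ.* suc t)
      ≡⟨ cong (λ s → at risingℕ s (j ℕ.* suc t)) split ⟩
    at risingℕ (j ℕ.* suc t ℕ.+ c) (j ℕ.* suc t)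
      ≡⟨ at-+ risingℕ (j ℕ.* suc t) c ⟩
    rising m (+ c)
      ≡⟨ cong (rising m) (sym (ℤ.⊖-≥ j≤at)) ⟩
    rising m (a ℕ.* t ℤ.⊖ j)
      ≡⟨ cong (rising m) (sym (ℤ.[+m]-[+n]≡m⊖n (a ℕ.* t) j)) ⟩
    rising m (+ (a ℕ.* t) - + j)
      ≡⟨ sym (at-+ (λ a → rising m (+ (a ℕ.* t) - + j)) j a) ⟩
    at (λ a → rising m (+ (a ℕ.* t) - + j)) (j ℕ.+ a) j ∎
    where
    risingℕ : ℕ → ℤ
    risingℕ a = rising m (+ a)
    c = a ℕ.* t ∸ j
    lemma : ∀ j t c → j ℕ.* t ℕ.+ (j ℕ.+ c) ≡ j ℕ.* suc t ℕ.+ c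
    lemma = ℕSolver.solve-∀
    split : (j ℕ.+ a) ℕ.* t ≡ j ℕ.* suc t ℕ.+ c
    split = trans (ℕ.*-distribʳ-+ t j a)
      (trans (cong (j ℕ.* t ℕ.+_) (sym (ℕ.m+[n∸m]≡n j≤at))) (lemma j t c))
  -- Here a t - j = -(d + 1) with d < j ≤ m, a root of `rising m`; on the other side (j + a) t < j
  -- (t + 1) triggers the cut-off.
  ... | inj₂ at<j = begin
    at risingℕ ((j ℕ.+ a) ℕ.* t) (j ℕ.* suc t)
      ≡⟨ at-> risingℕ ((j ℕ.+ a) ℕ.* t) (j ℕ.* suc t) beyond ⟩
    0ℤ
      ≡⟨ sym (rising-vanishes m d d<m) ⟩
    rising m (- + suc d)
      ≡⟨ cong (λ e → rising m (- + e)) (sym (ℕ.+-∸-assoc 1 at<j)) ⟩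
    rising m (- + (j ∸ a ℕ.* t))
      ≡⟨ cong (rising m) (sym (ℤ.⊖-≤ (ℕ.<⇒≤ at<j))) ⟩
    rising m (a ℕ.* t ℤ.⊖ j)
      ≡⟨ cong (rising m) (sym (ℤ.[+m]-[+n]≡m⊖n (a ℕ.* t) j)) ⟩
    rising m (+ (a ℕ.* t) - + j)
      ≡⟨ sym (at-+ (λ a → rising m (+ (a ℕ.* t) - + j)) j a) ⟩
    at (λ a → rising m (+ (a ℕ.* t) - + j)) (j ℕ.+ a) j ∎
    where
    risingℕ : ℕ → ℤ
    risingℕ a = rising m (+ a)
    d = j ∸ suc (a ℕ.* t)
    d<m : d < m
    d<m = ℕ.<-≤-trans (ℕ.∸-monoʳ-< {j} {suc (a ℕ.* t)} {0} (s≤s z≤n) at<j) (ℕ.≤-trans (ℕ.m≤m+n j a) j+a≤m)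
    beyond : (j ℕ.+ a) ℕ.* t < j ℕ.* suc t
    beyond = subst₂ _<_ (sym (ℕ.*-distribʳ-+ t j a)) (trans (ℕ.+-comm (j ℕ.* t) j) (sym (ℕ.*-suc j t)))
      (ℕ.+-monoʳ-< (j ℕ.* t) at<j)

-- For j ≤ k the argument (k - j) t - j may be negative where the left-hand
-- side is cut off, but then it is one of the roots -1, …, -m of rising m.
at-rising-dilate : ∀ m k t j → k ≤ m →
                at (λ a → rising m (+ a)) (k ℕ.* t) (j ℕ.* suc t) ≡
                at (λ a → rising m (+ (a ℕ.* t) - + j)) k j
at-rising-dilate m k t j k≤m with ℕ.≤-<-connex j k
... | inj₂ k<j = trans
  (at-> (λ a → rising m (+ a)) (k ℕ.* t) (j ℕ.* suc t)
    (ℕ.<-≤-trans (ℕ.≤-<-trans (ℕ.*-monoˡ-≤ t (ℕ.<⇒≤ k<j))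
      (ℕ.m<n+m (j ℕ.* t) (ℕ.≤-<-trans z≤n k<j))) (ℕ.≤-reflexive (sym (ℕ.*-suc j t)))))
  (sym (at-> _ k j k<j))
... | inj₁ j≤k = subst
  (λ k → at (λ a → rising m (+ a)) (k ℕ.* t) (j ℕ.* suc t) ≡ at (λ a → rising m (+ (a ℕ.* t) - + j)) k j)
  (ℕ.m+[n∸m]≡n j≤k)
  (at-rising-dilate-+ m t j (k ∸ j) (subst (_≤ m) (sym (ℕ.m+[n∸m]≡n j≤k)) k≤m))

-- The sum on the left counts the vectors in {0, ..., t}^(m+1) with sum k t. Rewriting m! as (1 -
-- z)^(m+1) times the rising-factorial series lets `∑-box` cancel the denominators, leaving (1 -
-- z^(t+1))^(m+1) applied to that series.
∑-box-δ₀ : ∀ m k t → k ≤ m →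
           + (m !) * ∑[ w ← box (Vec.replicate (suc m) (suc t)) ] at δ₀ (k ℕ.* t) (Vec.sum w) ≡
           D (suc m) (λ j → at (λ a → rising m (+ (a ℕ.* t) - + j)) k j)
∑-box-δ₀ m k t k≤m = begin
  + (m !) * ∑[ w ← ws ] at δ₀ s (Vec.sum w)
    ≡⟨ sym (∑-*ˡ ws (+ (m !)) _) ⟩
  ∑[ w ← ws ] (+ (m !) * at δ₀ s (Vec.sum w))
    ≡⟨ ∑-cong ws (λ w → sym (D-risinging m s (Vec.sum w))) ⟩
  ∑[ w ← ws ] D (suc m) (λ j → at (λ a → rising m (+ a)) s (Vec.sum w ℕ.+ j))
    ≡⟨ ∑-box (Vec.replicate (suc m) (suc t)) (at (λ a → rising m (+ a)) s) ⟩
  Z (Vec.toList (Vec.replicate (suc m) (suc t))) (at (λ a → rising m (+ a)) s)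
    ≡⟨ cong (λ L → Z L (at (λ a → rising m (+ a)) s)) (Vec.toList-replicate (suc m) (suc t)) ⟩
  Z (List.replicate (suc m) (suc t)) (at (λ a → rising m (+ a)) s)
    ≡⟨ Z-replicate (suc m) (suc t) (at (λ a → rising m (+ a)) s) ⟩
  D (suc m) (λ j → at (λ a → rising m (+ a)) s (j ℕ.* suc t))
    ≡⟨ D-cong (suc m) (λ j → at-rising-dilate m k t j k≤m) ⟩
  D (suc m) (λ j → at (λ a → rising m (+ (a ℕ.* t) - + j)) k j) ∎
  where
  ws = box (Vec.replicate (suc m) (suc t))
  s = k ℕ.* t

-- The permutations of 0, …, m + 1 that start with x + 1 and end with 0 have
-- descent polynomial (1 - z)^(m+1) Σ_a q m x a z^a.
q : ℕ → ℕ → ℕ → ℤ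
q m x zero    = 0ℤ
q m x (suc c) = (+ c) ^ x * (+ suc c) ^ (m ∸ x)

-- The two terms on the right have the common factor `q m y a`, with cofactors a and a - 1. This
-- makes sums over `y` telescope.
q-step : ∀ m y → y ≤ m → ∀ a → q m y a ≡ q (suc m) y a - q (suc m) (suc y) a
q-step m y y≤m zero    = refl
q-step m y y≤m (suc c) = begin
  X * Y                                     ≡⟨ lemma X Y (+ c) ⟩
  X * ((1ℤ + + c) * Y) - + c * X * Y        ≡⟨ cong (λ e → X * (+ suc c) ^ e - + c * X * Y) (sym (ℕ.+-∸-assoc 1 y≤m)) ⟩
  X * (+ suc c) ^ (suc m ∸ y) - + c * X * Y ∎
  where
  X = (+ c) ^ y
  Y = (+ suc c) ^ (m ∸ y)
  lemma : ∀ x y c → x * y ≡ x * ((1ℤ + c) * y) - c * x * y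
  lemma = solve-∀

-- The two ends of the telescoping sum agree up to a factor z, as a^(m+1) at a - 1 is (a - 1)^(m+1).
shift-q : ∀ m a → shift (q (suc m) 0) a ≡ q (suc m) (suc m) a
shift-q m zero          = refl
shift-q m (suc zero)    = refl
shift-q m (suc (suc c)) = trans (ℤ.*-comm 1ℤ _)
  (cong (λ e → (+ suc c) ^ suc m * (+ suc (suc c)) ^ e) (sym (ℕ.n∸n≡0 m)))

∑-split-telescope : ∀ n x (f g : ℕ → ℤ) → x ≤ n →
  ∑[ y ← upTo n ] (if y <ᵇ x then f y - f (suc y) else g y - g (suc y)) ≡
  (f 0 - f x) + (g x - g n)
∑-split-telescope n zero f g _ = begin
  ∑[ y ← upTo n ] (g y - g (suc y)) ≡⟨ ∑-telescope n g ⟩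
  g 0 - g n                         ≡⟨ lemma (f 0) _ ⟩
  (f 0 - f 0) + (g 0 - g n)         ∎
  where
  lemma : ∀ a b → b ≡ (a - a) + b
  lemma = solve-∀
∑-split-telescope (suc n) (suc x) f g (s≤s x≤n) = begin
  ∑[ y ← upTo (suc n) ] h y                              ≡⟨ ∑-upTo n h ⟩
  (f 0 - f 1) + ∑[ y ← upTo n ] h (suc y)                ≡⟨ +-congˡ (f 0 - f 1) (∑-split-telescope n x (f ∘ suc) (g ∘ suc) x≤n) ⟩
  (f 0 - f 1) + ((f 1 - f (suc x)) + (g (suc x) - g (suc n))) ≡⟨ lemma (f 0) (f 1) (f (suc x)) _ ⟩
  (f 0 - f (suc x)) + (g (suc x) - g (suc n))            ∎
  where
  h : ℕ → ℤ
  h y = if y <ᵇ suc x then f y - f (suc y) else g y - g (suc y)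
  lemma : ∀ a b c d → (a - b) + ((b - c) + d) ≡ (a - c) + d
  lemma = solve-∀

-- The transfer recursion for the first entry: a next entry below `x` costs one descent, hence a
-- factor z. With Q_y the series of `q (suc m) y`, the sum telescopes to z (Q_0 - Q_x) + (Q_x -
-- Q_(m+1)), and z Q_0 = Q_(m+1) leaves (1 - z) Q_x.
∑-q : ∀ m x k b → x ≤ suc m →
      ∑[ y ← upTo (suc m) ] (if y <ᵇ x then at (q m y) k (suc b) else at (q m y) k b) ≡
      at (q (suc m) x) k b - at (q (suc m) x) k (suc b)
∑-q m x k b x≤1+m = begin
  ∑[ y ← upTo (suc m) ] (if y <ᵇ x then at (q m y) k (suc b) else at (q m y) k b)
    ≡⟨ ∑-cong-∈ (upTo (suc m)) (λ {y} y∈ → cong₂ (λ u v → if y <ᵇ x then u else v)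
         (at-step (suc b) (∈-upTo⁻ y∈)) (at-step b (∈-upTo⁻ y∈))) ⟩
  ∑[ y ← upTo (suc m) ] (if y <ᵇ x then f (suc b) y - f (suc b) (suc y) else f b y - f b (suc y))
    ≡⟨ ∑-split-telescope (suc m) x (f (suc b)) (f b) x≤1+m ⟩
  (f (suc b) 0 - f (suc b) x) + (f b x - f b (suc m))
    ≡⟨ cong (λ z → (z - f (suc b) x) + (f b x - f b (suc m)))
         (trans (at-shift _ k b) (at-cong (shift-q m) k b)) ⟩
  (f b (suc m) - f (suc b) x) + (f b x - f b (suc m))
    ≡⟨ lemma (f b (suc m)) (f (suc b) x) (f b x) ⟩
  f b x - f (suc b) x ∎
  where
  f : ℕ → ℕ → ℤ
  f b y = at (q (suc m) y) k b
  at-step : ∀ b {y} → y < suc m → at (q m y) k b ≡ f b y - f b (suc y)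
  at-step b {y} (s≤s y≤m) =
    trans (at-cong (q-step m y y≤m) k b) (at-- (q (suc m) y) (q (suc m) (suc y)) k b)
  lemma : ∀ a b c → (a - b) + (c - a) ≡ c - b
  lemma = solve-∀

-- The two summands are the two halves of (1 - S) applied to h j = `u j * rising (suc m) (v j - j)`.
-- In the first, the extra factor is the last one of the longer product; in the second it is, up to
-- sign, the first one at j + 1.
D-risinging-step : ∀ m (u v : ℕ → ℤ) →
  D (suc m) (λ j → u j * (v j + (+ suc m - + j)) * rising m (v j - + j)) +
  D (suc m) (λ j → u (suc j) * (+ j - v (suc j)) * rising m (v (suc j) - + j)) ≡
  D (suc (suc m)) (λ j → u j * rising (suc m) (v j - + j))
D-risinging-step m u v = trans (sym (D-+ (suc m) f g)) (D-cong (suc m) λ j →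
  cong₂ _+_ (first (u j) (v j) (+ j) (rising m (v j - + j)) (+ suc m)) (second j))
  where
  f g : ℕ → ℤ
  f j = u j * (v j + (+ suc m - + j)) * rising m (v j - + j)
  g j = u (suc j) * (+ j - v (suc j)) * rising m (v (suc j) - + j)
  first : ∀ u v j r s → u * (v + (s - j)) * r ≡ u * (r * (v - j + s))
  first = solve-∀
  lemma₁ : ∀ v j → v - j ≡ v - (1ℤ + j) + 1ℤ
  lemma₁ = solve-∀
  lemma₂ : ∀ u v j r → u * (j - v) * r ≡ - (u * ((v - (1ℤ + j) + 1ℤ) * r))
  lemma₂ = solve-∀
  second : ∀ j → u (suc j) * (+ j - v (suc j)) * rising m (v (suc j) - + j) ≡
                 - (u (suc j) * rising (suc m) (v (suc j) - + suc j))
  second j = begin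
    u (suc j) * (+ j - v (suc j)) * rising m (v (suc j) - + j)
      ≡⟨ cong (λ y → u (suc j) * (+ j - v (suc j)) * rising m y) (lemma₁ (v (suc j)) (+ j)) ⟩
    u (suc j) * (+ j - v (suc j)) * rising m (v (suc j) - + suc j + 1ℤ)
      ≡⟨ lemma₂ (u (suc j)) (v (suc j)) (+ j) _ ⟩
    - (u (suc j) * ((v (suc j) - + suc j + 1ℤ) * rising m (v (suc j) - + suc j + 1ℤ)))
      ≡⟨ cong (λ y → - (u (suc j) * y)) (sym (rising-shift m (v (suc j) - + suc j))) ⟩
    - (u (suc j) * rising (suc m) (v (suc j) - + suc j)) ∎

-- Enumerations

Enumerates : Pred A 0ℓ → List A → Set
Enumerates P xs = Unique xs × (∀ x → x ∈ xs ⇔ P x)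

unique-↭ : ∀ {xs ys : List A} → Unique xs → Unique ys → (∀ x → x ∈ xs ⇔ x ∈ ys) → xs ↭ ys
unique-↭ xs! ys! eq = ∼bag⇒↭ (unique∧set⇒bag xs! ys! (λ {x} → eq x))

cardinality-unique : ∀ {P : Pred A 0ℓ} {M N} → HasCardinality P M → HasCardinality P N → M ≡ N
cardinality-unique (xs , xs! , xs⇔P , refl) (ys , ys! , ys⇔P , refl) =
  Perm.↭-length (unique-↭ xs! ys! (λ x → ⇔-sym (ys⇔P x) ⇔-∘ xs⇔P x))

enumerates⇒cardinality : ∀ {P : Pred A 0ℓ} {xs} → Enumerates P xs → HasCardinality P (length xs)
enumerates⇒cardinality {xs = xs} (xs! , xs⇔P) = xs , xs! , xs⇔P , refl

enumerates-filter : ∀ {P Q : Pred A 0ℓ} (Q? : Decidable Q) {xs} →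
                    Enumerates P xs → Enumerates (P ∩ Q) (filter Q? xs)
enumerates-filter Q? {xs} (xs! , xs⇔P) = Unique.filter⁺ Q? xs! , λ x → mk⇔
  (λ x∈ → let x∈xs , Qx = ∈-filter⁻ Q? x∈ in to (xs⇔P x) x∈xs , Qx)
  (λ (Px , Qx) → ∈-filter⁺ Q? (from (xs⇔P x) Px) Qx)

∑-filter : ∀ {Q : Pred A 0ℓ} (Q? : Decidable Q) xs →
           + length (filter Q? xs) ≡ ∑[ x ← xs ] (if does (Q? x) then 1ℤ else 0ℤ)
∑-filter Q? []       = refl
∑-filter Q? (x ∷ xs) with does (Q? x)
... | true  = +-congˡ 1ℤ (∑-filter Q? xs)
... | false = trans (∑-filter Q? xs) (sym (ℤ.+-identityˡ _))

module _ {B : A → Set} (h : ∀ x → B x → C) where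

  ∈-bind⁺ : ∀ {xs ys x y} → x ∈ xs → y ∈ ys x → h x y ∈ bind h xs ys
  ∈-bind⁺ {ys = ys} (here refl)           y∈ = ∈-++⁺ˡ (∈-map⁺ (h _) y∈)
  ∈-bind⁺ {ys = ys} (there {x = x′} x∈) y∈ = ∈-++⁺ʳ (List.map (h x′) (ys x′)) (∈-bind⁺ x∈ y∈)

  ∈-bind⁻ : ∀ xs {ys c} → c ∈ bind h xs ys → ∃[ x ] ∃[ y ] x ∈ xs × y ∈ ys x × h x y ≡ c
  ∈-bind⁻ (x ∷ xs) {ys} c∈ with ∈-++⁻ (List.map (h x) (ys x)) c∈
  ... | inj₁ c∈₁ = let y , y∈ , c≡ = ∈-map⁻ (h x) c∈₁ in x , y , here refl , y∈ , sym c≡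
  ... | inj₂ c∈₂ = let x′ , y , x∈ , y∈ , c≡ = ∈-bind⁻ xs c∈₂ in x′ , y , there x∈ , y∈ , c≡

  module _ (h-inj : ∀ {x x′ y y′} → h x y ≡ h x′ y′ → (x , y) ≡ (x′ , y′)) where

    unique-bind : ∀ {xs ys} → Unique xs → (∀ {x} → x ∈ xs → Unique (ys x)) → Unique (bind h xs ys)
    unique-bind []                       ys! = []
    unique-bind {x ∷ xs} {ys} xxs!@(_ ∷ xs!) ys! = Unique.++⁺
      (Unique.map⁺ (λ eq → inj (h-inj eq)) (ys! (here refl)))
      (unique-bind xs! (ys! ∘ there))
      disjoint
      where
      inj : ∀ {y y′ : B x} → (x , y) ≡ (x , y′) → y ≡ y′
      inj refl = refl
      disjoint : ∀ {c} → ¬ (c ∈ List.map (h x) (ys x) × c ∈ bind h xs ys)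
      disjoint (c∈₁ , c∈₂) with ∈-map⁻ (h x) c∈₁ | ∈-bind⁻ xs c∈₂
      ... | _ , _ , c≡₁ | x′ , _ , x′∈ , _ , c≡₂ with h-inj (trans c≡₂ c≡₁)
      ... | refl = Unique.Unique[x∷xs]⇒x∉xs xxs! x′∈

    enumerates-bind :
      ∀ {P : Pred A 0ℓ} {Q : ∀ x → Pred (B x) 0ℓ} {R : Pred C 0ℓ} {xs ys} →
      Enumerates P xs → (∀ {x} → P x → Enumerates (Q x) (ys x)) →
      (∀ {x y} → P x → Q x y → R (h x y)) →
      (∀ {c} → R c → ∃[ x ] ∃[ y ] P x × Q x y × h x y ≡ c) →
      Enumerates R (bind h xs ys)
    enumerates-bind {P = P} {Q} {R} {xs} {ys} (xs! , xs⇔P) ys-enum sound complete =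
      unique-bind xs! (λ {x} x∈ → proj₁ (ys-enum (to (xs⇔P x) x∈))) , λ c → mk⇔
        (λ c∈ → let x , y , x∈ , y∈ , c≡ = ∈-bind⁻ xs c∈
                    Px = to (xs⇔P x) x∈
                in subst R c≡ (sound Px (to (proj₂ (ys-enum Px) y) y∈)))
        (λ Rc → let x , y , Px , Qxy , c≡ = complete Rc
                in subst (_∈ bind h xs ys) c≡
                     (∈-bind⁺ (from (xs⇔P x) Px) (from (proj₂ (ys-enum Px) y) Qxy)))

enumerates-map : ∀ {P : Pred A 0ℓ} {R : Pred C 0ℓ} (h : A → C) {xs} →
                 (∀ {x y} → h x ≡ h y → x ≡ y) → Enumerates P xs →
                 (∀ {x} → P x → R (h x)) → (∀ {c} → R c → ∃[ x ] P x × h x ≡ c) →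
                 Enumerates R (List.map h xs)
enumerates-map {R = R} h {xs} h-inj (xs! , xs⇔P) sound complete = Unique.map⁺ h-inj xs! , λ c → mk⇔
  (λ c∈ → let x , x∈ , c≡ = ∈-map⁻ h c∈ in subst R (sym c≡) (sound (to (xs⇔P x) x∈)))
  (λ Rc → let x , Px , c≡ = complete Rc in subst (_∈ List.map h xs) c≡ (∈-map⁺ h (from (xs⇔P x) Px)))

module _ (proj : A → C) (proj-inj : ∀ {x y} → proj x ≡ proj y → x ≡ y)
         {P : Pred A 0ℓ} {R : Pred C 0ℓ}
         (P⇒R : ∀ {x} → P x → R (proj x)) (R⇒P : ∀ {c} → R c → ∃[ x ] P x × proj x ≡ c) where

  private
    lift : ∀ {cs} → All R cs → ∃[ xs ] List.map proj xs ≡ cs × All P xs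
    lift []         = [] , refl , []
    lift (Rc ∷ Rcs) =
      let x , Px , x≡ = R⇒P Rc; xs , xs≡ , Pxs = lift Rcs
      in x ∷ xs , cong₂ _∷_ x≡ xs≡ , Px ∷ Pxs

  -- A preimage is chosen for each listed value; injectivity of `proj` makes the chosen ones exhaust
  -- `P`. It transfers a count from plain data to records with irrelevant fields.
  cardinality-lift : ∀ {cs} → Enumerates R cs → HasCardinality P (length cs)
  cardinality-lift {cs} (cs! , cs⇔R) with lift (All.tabulate (λ {c} → to (cs⇔R c)))
  ... | xs , refl , Pxs = xs , Unique.map⁻ cs! , (λ x → mk⇔ (All.lookup Pxs) (λ Px →
    let x′ , x′∈ , x≡ = ∈-map⁻ proj (from (cs⇔R (proj x)) (P⇒R Px))
    in subst (_∈ xs) (sym (proj-inj x≡)) x′∈)) , sym (List.length-map proj xs)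

enumerates-allFin : ∀ n → Enumerates {A = Fin n} U (allFin n)
enumerates-allFin n = Unique.allFin⁺ n , λ x → mk⇔ (λ _ → _) (λ _ → ∈-allFin x)

enumerates-box : ∀ {r} (L : Vec ℕ r) → Enumerates (λ w → ∀ i → Vec.lookup w i < Vec.lookup L i) (box L)
enumerates-box []      = ([] ∷ []) , λ { [] → mk⇔ (λ _ ()) (λ _ → here refl) }
enumerates-box (ℓ ∷ L) = enumerates-bind _∷_ (λ { refl → refl })
  (Unique.upTo⁺ ℓ , λ x → mk⇔ ∈-upTo⁻ ∈-upTo⁺) (λ _ → enumerates-box L)
  (λ { x< w< zero → x< ; x< w< (suc i) → w< i })
  (λ { {x ∷ w} xw< → x , w , xw< zero , xw< ∘ suc , refl })

-- Building permutations one entry at a time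

module _ {n} (e : Fin n → Fin (suc n)) (e-inj : ∀ {x y} → e x ≡ e y → x ≡ y) where

  unique-map⁻ : ∀ {k} {v : Vec (Fin n) k} → VecUnique.Unique (Vec.map e v) → VecUnique.Unique v
  unique-map⁻ {v = []}    []        = []
  unique-map⁻ {v = x ∷ v} (x∉ ∷ v!) =
    VecAll.map (_∘ cong e) (VecAll.map⁻ x∉) ∷ unique-map⁻ v!

  map-inj : ∀ {k} {v w : Vec (Fin n) k} → Vec.map e v ≡ Vec.map e w → v ≡ w
  map-inj {v = []}    {[]}    _  = refl
  map-inj {v = x ∷ v} {y ∷ w} eq =
    cong₂ _∷_ (e-inj (Vec.∷-injectiveˡ eq)) (map-inj (Vec.∷-injectiveʳ eq))

-- Relabelling by any bijection onto the complement of the first entry enumerates the permutations.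
-- Two such families are used: `punchIn` preserves order, hence descents, and `swapIn` preserves the
-- cycle structure.
record Skips (e : ∀ {n} → Fin (suc n) → Fin n → Fin (suc n)) : Set where
  field
    injective  : ∀ {n} {c : Fin (suc n)} {x y} → e c x ≡ e c y → x ≡ y
    avoids     : ∀ {n} {c : Fin (suc n)} {x} → c ≢ e c x
    surjective : ∀ {n} {c z : Fin (suc n)} → c ≢ z → ∃[ x ] e c x ≡ z

  unique-∷⁺ : ∀ {n k} {c : Fin (suc n)} {v : Vec (Fin n) k} →
              VecUnique.Unique v → VecUnique.Unique (c ∷ Vec.map (e c) v)
  unique-∷⁺ {v = v} v! = VecAll.map⁺ (VecAll.universal (λ _ → avoids) v) ∷ VecUnique.map⁺ injective v!

  private
    unmap : ∀ {n k} {c : Fin (suc n)} {v : Vec (Fin (suc n)) k} →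
            VecAll.All (c ≢_) v → ∃[ v′ ] Vec.map (e c) v′ ≡ v
    unmap []           = [] , refl
    unmap (c≢z ∷ c∉v) =
      let x , x≡ = surjective c≢z; v′ , v≡ = unmap c∉v in x ∷ v′ , cong₂ _∷_ x≡ v≡

  unique-∷⁻ : ∀ {n k} {c : Fin (suc n)} {v : Vec (Fin (suc n)) k} →
              VecUnique.Unique (c ∷ v) → ∃[ v′ ] VecUnique.Unique v′ × Vec.map (e c) v′ ≡ v
  unique-∷⁻ (c∉v ∷ v!) with unmap c∉v
  ... | v′ , refl = v′ , unique-map⁻ (e _) injective v! , refl

  extend : ∀ {n k} → Fin (suc n) → Vec (Fin n) k → Vec (Fin (suc n)) (suc k)
  extend c v = c ∷ Vec.map (e c) v

  extend-injective : ∀ {n k} {c c′ : Fin (suc n)} {v v′ : Vec (Fin n) k} →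
                     extend c v ≡ extend c′ v′ → (c , v) ≡ (c′ , v′)
  extend-injective eq with Vec.∷-injectiveˡ eq
  ... | refl = cong (_ ,_) (map-inj (e _) injective (Vec.∷-injectiveʳ eq))

  perms : ∀ n → List (Vec (Fin n) n)
  perms zero    = [] ∷ []
  perms (suc n) = bind extend (allFin (suc n)) (λ _ → perms n)

  enumerates-perms : ∀ n → Enumerates VecUnique.Unique (perms n)
  enumerates-perms zero    = ([] ∷ []) , λ { [] → mk⇔ (λ _ → []) (λ _ → here refl) }
  enumerates-perms (suc n) = enumerates-bind extend extend-injective
    (enumerates-allFin (suc n)) (λ _ → enumerates-perms n) (λ _ → unique-∷⁺)
    (λ { {c ∷ v} cv! → let v′ , v′! , v≡ = unique-∷⁻ cv! in c , v′ , _ , v′! , cong (c ∷_) v≡ })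

skips-punchIn : Skips punchIn
skips-punchIn = record
  { injective  = λ {_} {c} {x} {y} → Fin.punchIn-injective c x y
  ; avoids     = λ {_} {c} {x} → Fin.punchInᵢ≢i c x ∘ sym
  ; surjective = λ c≢z → punchOut c≢z , Fin.punchIn-punchOut c≢z
  }

-- This is `suc` followed by the transposition of 0 and `c`. Extending σ by it therefore composes
-- that transposition with σ enlarged by a fixed point 0.
swapIn : ∀ {n} → Fin (suc n) → Fin n → Fin (suc n)
swapIn zero    x = suc x
swapIn (suc c) x = if does (x Fin.≟ c) then zero else suc x

skips-swapIn : Skips swapIn
skips-swapIn = record { injective = λ {_} {c} → inj c _ _ ; avoids = avoid _ _ ; surjective = surj _ _ }
  where
  inj : ∀ {n} (c : Fin (suc n)) x y → swapIn c x ≡ swapIn c y → x ≡ y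
  inj zero    x y refl = refl
  inj (suc c) x y eq with x Fin.≟ c | y Fin.≟ c
  ... | yes refl | yes refl = refl
  ... | no _     | no _     = Fin.suc-injective eq

  avoid : ∀ {n} (c : Fin (suc n)) x → c ≢ swapIn c x
  avoid (suc c) x eq with x Fin.≟ c
  ... | no x≢c = x≢c (sym (Fin.suc-injective eq))

  surj : ∀ {n} (c z : Fin (suc n)) → c ≢ z → ∃[ x ] swapIn c x ≡ z
  surj zero    zero    c≢z = contradiction refl c≢z
  surj zero    (suc z) c≢z = z , refl
  surj (suc c) zero    c≢z = c , helper
    where
    helper : swapIn (suc c) c ≡ zero
    helper with c Fin.≟ c
    ... | yes _  = refl
    ... | no c≢c = contradiction refl c≢c
  surj (suc c) (suc z) c≢z = z , helper
    where
    helper : swapIn (suc c) z ≡ suc z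
    helper with z Fin.≟ c
    ... | yes refl = contradiction refl c≢z
    ... | no _     = refl

-- Descents

at-δ₀ : ∀ k b → at δ₀ k b ≡ (if k ≡ᵇ b then 1ℤ else 0ℤ)
at-δ₀ zero    zero    = refl
at-δ₀ (suc k) zero    = refl
at-δ₀ zero    (suc b) = refl
at-δ₀ (suc k) (suc b) = at-δ₀ k b

indicator : Bool → ℕ
indicator b = if b then 1 else 0

∣∷∣ : ∀ b {n} (S : Subset n) → ∣ b ∷ S ∣ ≡ indicator b ℕ.+ ∣ S ∣
∣∷∣ true  S = refl
∣∷∣ false S = refl

-- Length and range of entries are independent here, because the tail of a permutation is not a
-- permutation and `des` could not recurse on it.
descents : ∀ {n r} → Vec (Fin n) r → ℕ
descents []          = 0
descents (x ∷ [])    = 0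
descents (x ∷ y ∷ v) = indicator (toℕ y <ᵇ toℕ x) ℕ.+ descents (y ∷ v)

module _ {n : ℕ} where

  private
    DescentAt : ∀ {r} → Vec (Fin n) r → Pred (Fin r) 0ℓ
    DescentAt p i = ∃[ j ] toℕ j ≡ suc (toℕ i) × Vec.lookup p j Fin.< Vec.lookup p i

    descentAt? : ∀ {r} (p : Vec (Fin n) r) i → Dec (DescentAt p i)
    descentAt? p i = Fin.any? λ j →
      (toℕ j ℕ.≟ suc (toℕ i)) ×-dec (Vec.lookup p j Fin.<? Vec.lookup p i)

    at-zero : ∀ {r} x y (v : Vec (Fin n) r) →
              does (descentAt? (x ∷ y ∷ v) zero) ≡ (toℕ y <ᵇ toℕ x)
    at-zero x y v = does-⇔
      (mk⇔ (λ { (suc zero , _ , y<x) → y<x }) (λ y<x → suc zero , refl , y<x))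
      (descentAt? (x ∷ y ∷ v) zero) (y Fin.<? x)

    at-suc : ∀ {r} x (v : Vec (Fin n) r) i →
             does (descentAt? (x ∷ v) (suc i)) ≡ does (descentAt? v i)
    at-suc x v i = does-⇔
      (mk⇔ (λ { (suc j , j≡ , <) → j , ℕ.suc-injective j≡ , < })
           (λ { (j , j≡ , <) → suc j , cong suc j≡ , < }))
      (descentAt? (x ∷ v) (suc i)) (descentAt? v i)

  count-descents : ∀ {r} (v : Vec (Fin n) r) →
                   ∣ Vec.tabulate (λ i → does (descentAt? v i)) ∣ ≡ descents v
  count-descents []          = refl
  count-descents (x ∷ [])    = refl
  count-descents (x ∷ y ∷ v) = trans
    (∣∷∣ (does (descentAt? (x ∷ y ∷ v) zero))
      (Vec.tabulate (λ i → does (descentAt? (x ∷ y ∷ v) (suc i)))))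
    (cong₂ ℕ._+_ (cong indicator (at-zero x y v))
      (trans (cong ∣_∣ (Vec.tabulate-cong (at-suc x (y ∷ v)))) (count-descents (y ∷ v))))

des≡descents : ∀ {r} (p : Vec (Fin r) r) → des p ≡ descents p
des≡descents p = count-descents p

punchIn-<ᵇ-punchIn : ∀ {n} c (x y : Fin n) →
                     (toℕ (punchIn c x) <ᵇ toℕ (punchIn c y)) ≡ (toℕ x <ᵇ toℕ y)
punchIn-<ᵇ-punchIn zero    x       y       = refl
punchIn-<ᵇ-punchIn (suc c) zero    zero    = refl
punchIn-<ᵇ-punchIn (suc c) zero    (suc y) = refl
punchIn-<ᵇ-punchIn (suc c) (suc x) zero    = refl
punchIn-<ᵇ-punchIn (suc c) (suc x) (suc y) = punchIn-<ᵇ-punchIn c x y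

punchIn-<ᵇ : ∀ {n} c (x : Fin n) → (toℕ (punchIn c x) <ᵇ toℕ c) ≡ (toℕ x <ᵇ toℕ c)
punchIn-<ᵇ zero    x       = refl
punchIn-<ᵇ (suc c) zero    = refl
punchIn-<ᵇ (suc c) (suc x) = punchIn-<ᵇ c x

descents-punchIn : ∀ {n r} c (v : Vec (Fin n) r) → descents (Vec.map (punchIn c) v) ≡ descents v
descents-punchIn c []          = refl
descents-punchIn c (x ∷ [])    = refl
descents-punchIn c (x ∷ y ∷ v) = cong₂ ℕ._+_
  (cong indicator (punchIn-<ᵇ-punchIn c y x)) (descents-punchIn c (y ∷ v))

open Skips skips-punchIn using () renaming
  ( extend to prepend; extend-injective to prepend-injective
  ; unique-∷⁺ to unique-prepend⁺; unique-∷⁻ to unique-prepend⁻)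

descents-prepend : ∀ {n r} c (p : Vec (Fin n) (suc r)) →
                  descents (prepend c p) ≡ indicator (toℕ (head p) <ᵇ toℕ c) ℕ.+ descents p
descents-prepend c (x ∷ v) = cong₂ ℕ._+_
  (cong indicator (punchIn-<ᵇ c x)) (descents-punchIn c (x ∷ v))

-- Orders of the cycles and Worpitzky's identity

LastZero : ∀ {r} → Pred (Vec (Fin r) r) 0ℓ
LastZero {r} p = ∀ i → suc (toℕ i) ≡ r → toℕ (Vec.lookup p i) ≡ 0

-- From length 2 on the first entry is not 0, that value being reserved for the last place;
-- `punchIn (suc x)` fixes 0, so the condition passes to the shorter permutation.
lastZero : ∀ r → List (Vec (Fin r) r)
lastZero zero          = [] ∷ []
lastZero (suc zero)    = (zero ∷ []) ∷ []
lastZero (suc (suc m)) = bind (prepend ∘ suc) (allFin (suc m)) (λ _ → lastZero (suc m))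

enumerates-lastZero : ∀ r → Enumerates (VecUnique.Unique ∩ LastZero) (lastZero r)
enumerates-lastZero zero = ([] ∷ []) , λ { [] → mk⇔ (λ _ → [] , λ ()) (λ _ → here refl) }
enumerates-lastZero (suc zero) = ([] ∷ []) , λ { (zero ∷ []) →
  mk⇔ (λ _ → ([] ∷ []) , λ { zero _ → refl }) (λ _ → here refl) }
enumerates-lastZero (suc (suc m)) = enumerates-bind (prepend ∘ suc) inj
  (enumerates-allFin (suc m)) (λ _ → enumerates-lastZero (suc m))
  (λ { {x} {p} _ (p! , p-last) → unique-prepend⁺ p! , sound x p p-last }) complete
  where
  inj : ∀ {x x′} {p p′ : Vec (Fin (suc m)) (suc m)} →
        prepend (suc x) p ≡ prepend (suc x′) p′ → (x , p) ≡ (x′ , p′)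
  inj eq with prepend-injective eq
  ... | refl = refl

  sound : ∀ x p → LastZero p → LastZero (prepend (suc x) p)
  sound x p p-last (suc i) i-last
    rewrite Vec.lookup-map i (punchIn (suc x)) p
    with Vec.lookup p i | p-last i (ℕ.suc-injective i-last)
  ... | zero | _ = refl

  complete : ∀ {c} → (VecUnique.Unique ∩ LastZero) c →
             ∃[ x ] ∃[ p ] _ × (VecUnique.Unique ∩ LastZero) p × prepend (suc x) p ≡ c
  complete {zero ∷ v} ((0∉v ∷ _) , c-last) = contradiction
    (sym (Fin.toℕ-injective (c-last (Fin.fromℕ (suc m)) (cong suc (Fin.toℕ-fromℕ (suc m))))))
    (VecAll.lookup⁺ 0∉v (Fin.fromℕ m))
  complete {suc x ∷ v} (c! , c-last) with unique-prepend⁻ c!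
  ... | p , p! , refl = x , p , _ , (p! , p-last) , refl
    where
    p-last : LastZero p
    p-last i i-last with Vec.lookup p i | sym (Vec.lookup-map i (punchIn (suc x)) p) | c-last (suc i) (cong suc i-last)
    ... | zero  | _  | _   = refl
    ... | suc y | eq | c≡0 with trans (cong toℕ eq) c≡0
    ... | ()

∑-allFin : ∀ n (f : ℕ → ℤ) → ∑[ i ← allFin n ] f (toℕ i) ≡ ∑ (upTo n) f
∑-allFin zero    f = refl
∑-allFin (suc n) f = begin
  f 0 + ∑ (List.tabulate {n = n} Fin.suc) (f ∘ toℕ)
    ≡⟨ cong (λ is → f 0 + ∑ is (f ∘ toℕ)) (sym (List.map-tabulate {n = n} id Fin.suc)) ⟩
  f 0 + ∑ (List.map Fin.suc (allFin n)) (f ∘ toℕ)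
    ≡⟨ +-congˡ (f 0) (trans (∑-map suc (allFin n) (f ∘ toℕ)) (∑-allFin n (f ∘ suc))) ⟩
  f 0 + ∑ (upTo n) (f ∘ suc)
    ≡⟨ sym (∑-upTo n f) ⟩
  ∑ (upTo (suc n)) f ∎

-- Induction on the length, splitting by the second entry `suc y`: there is a descent in front
-- exactly if `y < x`, and `∑-q` sums the resulting cases. The shortest permutation, 1 then 0, gives
-- z = (1 - z) Σ_(a ≥ 1) z^a.
∑-lastZero-prepend : ∀ m (x : Fin (suc m)) k b →
  ∑[ p ← lastZero (suc m) ] at δ₀ k (b ℕ.+ descents (prepend (suc x) p)) ≡
  D (suc m) (λ j → at (q m (toℕ x)) k (b ℕ.+ j))
∑-lastZero-prepend zero zero k b = begin
  at δ₀ k (b ℕ.+ 1) + 0ℤ                        ≡⟨ ℤ.+-identityʳ _ ⟩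
  at δ₀ k (b ℕ.+ 1)                             ≡⟨ cong (at δ₀ k) (ℕ.+-comm b 1) ⟩
  at δ₀ k (suc b)                               ≡⟨ sym (D-1 k (suc b)) ⟩
  D 1 (λ j → at (λ _ → 1ℤ) k (suc (b ℕ.+ j)))   ≡⟨ D-cong 1 (λ j → trans (at-shift _ k (b ℕ.+ j)) (at-cong shift-1 k (b ℕ.+ j))) ⟩
  D 1 (λ j → at (q 0 0) k (b ℕ.+ j))            ∎
  where
  shift-1 : ∀ a → shift (λ _ → 1ℤ) a ≡ q 0 0 a
  shift-1 zero    = refl
  shift-1 (suc a) = refl
∑-lastZero-prepend (suc m) x k b = begin
  ∑[ p ← lastZero (suc (suc m)) ] at δ₀ k (b ℕ.+ descents (prepend (suc x) p))
    ≡⟨ ∑-bind (prepend ∘ suc) (allFin (suc m)) (λ _ → lastZero (suc m)) _ ⟩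
  ∑[ y ← allFin (suc m) ] ∑[ p ← lastZero (suc m) ] at δ₀ k (b ℕ.+ descents (prepend (suc x) (prepend (suc y) p)))
    ≡⟨ ∑-cong (allFin (suc m)) (λ y → trans
         (∑-cong (lastZero (suc m)) (λ p → cong (λ d → at δ₀ k (b ℕ.+ d)) (descents-prepend (suc x) (prepend (suc y) p))))
         (case-split y)) ⟩
  ∑[ y ← allFin (suc m) ] D (suc m) (λ j → term (toℕ y) (b ℕ.+ j))
    ≡⟨ sym (D-∑ (suc m) (allFin (suc m)) (λ y j → term (toℕ y) (b ℕ.+ j))) ⟩
  D (suc m) (λ j → ∑[ y ← allFin (suc m) ] term (toℕ y) (b ℕ.+ j))
    ≡⟨ D-cong (suc m) (λ j → trans (∑-allFin (suc m) (λ y → term y (b ℕ.+ j)))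
         (∑-q m (toℕ x) k (b ℕ.+ j) (ℕ.s≤s⁻¹ (Fin.toℕ<n x)))) ⟩
  D (suc m) (λ j → at (q (suc m) (toℕ x)) k (b ℕ.+ j) - at (q (suc m) (toℕ x)) k (suc (b ℕ.+ j)))
    ≡⟨ D-cong (suc m) (λ j → cong (λ i → at (q (suc m) (toℕ x)) k (b ℕ.+ j) - at (q (suc m) (toℕ x)) k i)
         (sym (ℕ.+-suc b j))) ⟩
  D (suc (suc m)) (λ j → at (q (suc m) (toℕ x)) k (b ℕ.+ j)) ∎
  where
  term : ℕ → ℕ → ℤ
  term y b = if y <ᵇ toℕ x then at (q m y) k (suc b) else at (q m y) k b

  case-split : ∀ y →
    ∑[ p ← lastZero (suc m) ] at δ₀ k (b ℕ.+ (indicator (toℕ y <ᵇ toℕ x) ℕ.+ descents (prepend (suc y) p))) ≡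
    D (suc m) (λ j → term (toℕ y) (b ℕ.+ j))
  case-split y with toℕ y <ᵇ toℕ x
  ... | false = ∑-lastZero-prepend m y k b
  ... | true  = trans
    (∑-cong (lastZero (suc m)) (λ p → cong (at δ₀ k) (ℕ.+-suc b (descents (prepend (suc y) p)))))
    (∑-lastZero-prepend m y k (suc b))

-- Worpitzky's identity: the Eulerian polynomial is (1 - z)^(m+1) Σ_a a^m z^a.
∑-lastZero : ∀ m k b → ∑[ p ← lastZero (suc m) ] at δ₀ k (b ℕ.+ des p) ≡
             D (suc m) (λ j → at (λ a → (+ a) ^ m) k (b ℕ.+ j))
∑-lastZero zero k b = begin
  at δ₀ k (b ℕ.+ 0) + 0ℤ                 ≡⟨ ℤ.+-identityʳ _ ⟩
  at δ₀ k (b ℕ.+ 0)                      ≡⟨ cong (at δ₀ k) (ℕ.+-identityʳ b) ⟩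
  at δ₀ k b                              ≡⟨ sym (D-1 k b) ⟩
  D 1 (λ j → at (λ _ → 1ℤ) k (b ℕ.+ j))  ∎
∑-lastZero (suc m) k b = begin
  ∑[ p ← lastZero (suc (suc m)) ] at δ₀ k (b ℕ.+ des p)
    ≡⟨ ∑-bind (prepend ∘ suc) (allFin (suc m)) (λ _ → lastZero (suc m)) _ ⟩
  ∑[ y ← allFin (suc m) ] ∑[ p ← lastZero (suc m) ] at δ₀ k (b ℕ.+ des (prepend (suc y) p))
    ≡⟨ ∑-cong (allFin (suc m)) (λ y → trans
         (∑-cong (lastZero (suc m)) (λ p → cong (λ d → at δ₀ k (b ℕ.+ d)) (des≡descents (prepend (suc y) p))))
         (∑-lastZero-prepend m y k b)) ⟩
  ∑[ y ← allFin (suc m) ] D (suc m) (λ j → at (q m (toℕ y)) k (b ℕ.+ j))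
    ≡⟨ sym (D-∑ (suc m) (allFin (suc m)) (λ y j → at (q m (toℕ y)) k (b ℕ.+ j))) ⟩
  D (suc m) (λ j → ∑[ y ← allFin (suc m) ] at (q m (toℕ y)) k (b ℕ.+ j))
    -- With x = 0 no `y` lies below x, so `∑-q` is here the plain sum over all first entries.
    ≡⟨ D-cong (suc m) (λ j → trans (∑-allFin (suc m) (λ y → at (q m y) k (b ℕ.+ j)))
         (∑-q m 0 k (b ℕ.+ j) z≤n)) ⟩
  D (suc m) (λ j → at (q (suc m) 0) k (b ℕ.+ j) - at (q (suc m) 0) k (suc (b ℕ.+ j)))
    ≡⟨ D-cong (suc m) (λ j → cong (λ i → at (q (suc m) 0) k (b ℕ.+ j) - at (q (suc m) 0) k i)
         (sym (ℕ.+-suc b j))) ⟩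
  D (suc (suc m)) (λ j → at (q (suc m) 0) k (b ℕ.+ j))
    ≡⟨ D-cong (suc (suc m)) (λ j → at-cong q-0 k (b ℕ.+ j)) ⟩
  D (suc (suc m)) (λ j → at (λ a → (+ a) ^ suc m) k (b ℕ.+ j)) ∎
  where
  q-0 : ∀ a → q (suc m) 0 a ≡ (+ a) ^ suc m
  q-0 zero    = refl
  q-0 (suc c) = ℤ.*-identityˡ _

-- Cycles

Reaches : (A → A) → A → A → Set
Reaches f x y = ∃[ t ] iterate f x t ≡ y

module _ (f : A → A) where

  iterate-+ : ∀ x s t → iterate f x (s ℕ.+ t) ≡ iterate f (iterate f x s) t
  iterate-+ x zero    t = refl
  iterate-+ x (suc s) t = iterate-+ (f x) s t

  iterate-period : ∀ x d → iterate f x d ≡ x → ∀ q → iterate f x (q ℕ.* d) ≡ x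
  iterate-period x d d-period zero    = refl
  iterate-period x d d-period (suc q) = begin
    iterate f x (d ℕ.+ q ℕ.* d)           ≡⟨ iterate-+ x d (q ℕ.* d) ⟩
    iterate f (iterate f x d) (q ℕ.* d)   ≡⟨ cong (λ y → iterate f y (q ℕ.* d)) d-period ⟩
    iterate f x (q ℕ.* d)                 ≡⟨ iterate-period x d d-period q ⟩
    x                                     ∎

  iterate-injective : (∀ {x y} → f x ≡ f y → x ≡ y) →
                      ∀ t {x y} → iterate f x t ≡ iterate f y t → x ≡ y
  iterate-injective f-inj zero    eq = eq
  iterate-injective f-inj (suc t) eq = f-inj (iterate-injective f-inj t eq)

  reaches-trans : ∀ {x y z} → Reaches f x y → Reaches f y z → Reaches f x z
  reaches-trans {x} (s , refl) (t , refl) = s ℕ.+ t , iterate-+ x s t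

  ∈-iterate⁻ : ∀ x n {y} → y ∈ List.iterate f x n → Reaches f x y
  ∈-iterate⁻ x (suc n) (here refl) = 0 , refl
  ∈-iterate⁻ x (suc n) (there y∈)  = let t , eq = ∈-iterate⁻ (f x) n y∈ in suc t , eq

  ∈-iterate⁺ : ∀ x {n t} → t < n → iterate f x t ∈ List.iterate f x n
  ∈-iterate⁺ x {suc n} {zero}  _         = here refl
  ∈-iterate⁺ x {suc n} {suc t} (s≤s t<n) = there (∈-iterate⁺ (f x) t<n)

∈-⋃-⁅⁆ : ∀ {n} {x : Fin n} xs → x ∈ˢ ⋃ (List.map ⁅_⁆ xs) ⇔ x ∈ xs
∈-⋃-⁅⁆ []       = mk⇔ (λ x∈ → contradiction x∈ Subset.∉⊥) (λ ())
∈-⋃-⁅⁆ (y ∷ ys) = mk⇔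
  (λ x∈ → [ here ∘ Subset.x∈⁅y⁆⇒x≡y y , there ∘ to (∈-⋃-⁅⁆ ys) ]′ (Subset.x∈p∪q⁻ ⁅ y ⁆ _ x∈))
  (λ { (here refl) → Subset.x∈p∪q⁺ (inj₁ (Subset.x∈⁅x⁆ y))
     ; (there x∈)  → Subset.x∈p∪q⁺ (inj₂ (from (∈-⋃-⁅⁆ ys) x∈)) })

module Orbit {n} (σ : Vec (Fin n) n) (σ! : VecUnique.Unique σ) where

  private
    f : Fin n → Fin n
    f = lookup σ

    f-inj : ∀ {x y} → f x ≡ f y → x ≡ y
    f-inj = VecUnique.lookup-injective σ! _ _

  -- Two of the n + 1 points x, f x, ..., f^n x coincide, and injectivity cancels the iterates that
  -- they have in common. The period is at most n, which is why n iterates fill an orbit.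
  period : ∀ x → ∃[ d ] suc d ≤ n × iterate f x (suc d) ≡ x
  period x with Fin.pigeonhole (ℕ.n<1+n n) (λ i → iterate f x (toℕ i))
  ... | i , j , i<j , eq =
    d , ℕ.≤-trans (ℕ.m≤m+n (suc d) (toℕ i)) (subst (_≤ n) (sym d+i≡j) (ℕ.s≤s⁻¹ (Fin.toℕ<n j))) ,
    iterate-injective f f-inj (toℕ i) (begin
      iterate f (iterate f x (suc d)) (toℕ i) ≡⟨ sym (iterate-+ f x (suc d) (toℕ i)) ⟩
      iterate f x (suc d ℕ.+ toℕ i)           ≡⟨ cong (iterate f x) d+i≡j ⟩
      iterate f x (toℕ j)                     ≡⟨ sym eq ⟩
      iterate f x (toℕ i)                     ∎)
    where
    d = toℕ j ∸ suc (toℕ i)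
    d+i≡j : suc d ℕ.+ toℕ i ≡ toℕ j
    d+i≡j = trans (sym (ℕ.+-suc d (toℕ i))) (ℕ.m∸n+n≡m i<j)

  ∈-orbit : ∀ x {y} → y ∈ˢ orbit σ x ⇔ Reaches f x y
  ∈-orbit x {y} = mk⇔
    (∈-iterate⁻ f x n ∘ to (∈-⋃-⁅⁆ (List.iterate f x n)))
    (from (∈-⋃-⁅⁆ (List.iterate f x n)) ∘ bounded)
    where
    bounded : Reaches f x y → y ∈ List.iterate f x n
    bounded (t , refl) with period x
    ... | d , d<n , d-period = subst (_∈ List.iterate f x n) (sym (begin
      iterate f x t                                               ≡⟨ cong (iterate f x) (m≡m%n+[m/n]*n t (suc d)) ⟩
      iterate f x (t % suc d ℕ.+ t / suc d ℕ.* suc d)             ≡⟨ cong (iterate f x) (ℕ.+-comm (t % suc d) _) ⟩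
      iterate f x (t / suc d ℕ.* suc d ℕ.+ t % suc d)             ≡⟨ iterate-+ f x (t / suc d ℕ.* suc d) (t % suc d) ⟩
      iterate f (iterate f x (t / suc d ℕ.* suc d)) (t % suc d)   ≡⟨ cong (λ y → iterate f y (t % suc d)) (iterate-period f x (suc d) d-period (t / suc d)) ⟩
      iterate f x (t % suc d)                                     ∎))
      (∈-iterate⁺ f x (ℕ.<-≤-trans (m%n<n t (suc d)) d<n))

  reaches-sym : ∀ {x y} → Reaches f x y → Reaches f y x
  reaches-sym {x} (t , refl) with period x
  -- A further t d steps make t (d + 1) in total, a multiple of the period, so no inverse of σ is
  -- needed.
  ... | d , _ , d-period = t ℕ.* d , (begin
    iterate f (iterate f x t) (t ℕ.* d) ≡⟨ sym (iterate-+ f x t (t ℕ.* d)) ⟩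
    iterate f x (t ℕ.+ t ℕ.* d)         ≡⟨ cong (iterate f x) (sym (ℕ.*-suc t d)) ⟩
    iterate f x (t ℕ.* suc d)           ≡⟨ iterate-period f x (suc d) d-period t ⟩
    x                                   ∎)

  orbit-≡ : ∀ x {y} → y ∈ˢ orbit σ x → orbit σ x ≡ orbit σ y
  orbit-≡ x {y} y∈ = Subset.⊆-antisym
    (λ z∈ → from (∈-orbit y) (reaches-trans f (reaches-sym (to (∈-orbit x) y∈)) (to (∈-orbit x) z∈)))
    (λ z∈ → from (∈-orbit x) (reaches-trans f (to (∈-orbit x) y∈) (to (∈-orbit y) z∈)))

  ∈-cycles : ∀ {C} → C ∈ cycles σ ⇔ (∃[ x ] C ≡ orbit σ x)
  ∈-cycles = mk⇔
    (λ C∈ → let x , _ , C≡ = ∈-map⁻ (orbit σ) (∈-deduplicate⁻ _≟_ (List.map (orbit σ) (allFin n)) C∈) in x , C≡)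
    (λ { (x , refl) → ∈-deduplicate⁺ _≟_ (∈-map⁺ (orbit σ) (∈-allFin x)) })
    where _≟_ = Vec.≡-dec Bool._≟_

cycles-unique : ∀ {n} (σ : Vec (Fin n) n) → Unique (cycles σ)
cycles-unique σ = DecUnique.deduplicate-! (Vec.≡-dec Bool._≟_) (List.map (orbit σ) (allFin _))

-- Cycles after the insertion of an element

open Skips skips-swapIn using (perms; enumerates-perms)
  renaming (extend to insert; unique-∷⁺ to unique-insert)

-- insert (suc i) σ inserts the new element zero just before i in its cycle;
-- insert zero σ makes it a fixed point.
module Insert {n} (σ : Vec (Fin n) n) (σ! : VecUnique.Unique σ) where

  open Orbit σ σ!

  private
    f = lookup σ

  insert-fixed : ∀ j → lookup (insert zero σ) (suc j) ≡ suc (f j)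
  insert-fixed j = Vec.lookup-map j suc σ

  fixed-zero : ∀ t → iterate (lookup (insert zero σ)) zero t ≡ zero
  fixed-zero zero    = refl
  fixed-zero (suc t) = fixed-zero t

  fixed-suc : ∀ j t → iterate (lookup (insert zero σ)) (suc j) t ≡ suc (iterate f j t)
  fixed-suc j zero    = refl
  fixed-suc j (suc t) = trans
    (cong (λ x → iterate (lookup (insert zero σ)) x t) (insert-fixed j)) (fixed-suc (f j) t)

  module Fixed where
    open Orbit (insert zero σ) (unique-insert σ!) renaming (∈-orbit to ∈-orbit′; ∈-cycles to ∈-cycles′)

    orbit-zero : orbit (insert zero σ) zero ≡ inside ∷ ⊥
    orbit-zero = Subset.⊆-antisym ⊆ ⊇
      where
      ⊆ : ∀ {y} → y ∈ˢ orbit (insert zero σ) zero → y ∈ˢ inside ∷ ⊥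
      ⊆ y∈ with to (∈-orbit′ zero) y∈
      ... | t , refl rewrite fixed-zero t = Vec.here
      ⊇ : ∀ {y} → y ∈ˢ inside ∷ ⊥ → y ∈ˢ orbit (insert zero σ) zero
      ⊇ Vec.here        = from (∈-orbit′ zero) (0 , refl)
      ⊇ (Vec.there y∈⊥) = contradiction y∈⊥ Subset.∉⊥

    orbit-suc : ∀ j → orbit (insert zero σ) (suc j) ≡ outside ∷ orbit σ j
    orbit-suc j = Subset.⊆-antisym ⊆ ⊇
      where
      ⊆ : ∀ {y} → y ∈ˢ orbit (insert zero σ) (suc j) → y ∈ˢ outside ∷ orbit σ j
      ⊆ y∈ with to (∈-orbit′ (suc j)) y∈
      ... | t , refl rewrite fixed-suc j t = Vec.there (from (∈-orbit j) (t , refl))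
      ⊇ : ∀ {y} → y ∈ˢ outside ∷ orbit σ j → y ∈ˢ orbit (insert zero σ) (suc j)
      ⊇ (Vec.there y∈) with to (∈-orbit j) y∈
      ... | t , refl = from (∈-orbit′ (suc j)) (t , fixed-suc j t)

    cycles-↭ : cycles (insert zero σ) ↭ (inside ∷ ⊥) ∷ List.map (outside ∷_) (cycles σ)
    cycles-↭ = unique-↭ (cycles-unique (insert zero σ))
      (All.tabulate fresh ∷ Unique.map⁺ Vec.∷-injectiveʳ (cycles-unique σ))
      (λ C → mk⇔ (λ C∈ → forward (to ∈-cycles′ C∈)) backward)
      where
      fresh : ∀ {C} → C ∈ List.map (outside ∷_) (cycles σ) → inside ∷ ⊥ ≢ C
      fresh C∈ refl with ∈-map⁻ (outside ∷_) C∈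
      ... | _ , _ , ()
      forward : ∀ {C} → ∃[ x ] C ≡ orbit (insert zero σ) x →
                C ∈ (inside ∷ ⊥) ∷ List.map (outside ∷_) (cycles σ)
      forward (zero  , refl) = here orbit-zero
      forward (suc j , refl) = there (subst (_∈ _) (sym (orbit-suc j))
        (∈-map⁺ (outside ∷_) (from ∈-cycles (j , refl))))
      backward : ∀ {C} → C ∈ (inside ∷ ⊥) ∷ List.map (outside ∷_) (cycles σ) →
                 C ∈ cycles (insert zero σ)
      backward (here refl) = from ∈-cycles′ (zero , sym orbit-zero)
      backward (there C∈) with ∈-map⁻ (outside ∷_) C∈
      ... | C′ , C′∈ , refl with to ∈-cycles C′∈
      ... | j , refl = from ∈-cycles′ (suc j , sym (orbit-suc j))

  module Before (i : Fin n) where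

    private
      σ′ = insert (suc i) σ
      f′ = lookup σ′

    open Orbit σ′ (unique-insert σ!)
      renaming (∈-orbit to ∈-orbit′; ∈-cycles to ∈-cycles′; reaches-sym to reaches-sym′)

    -- Collapses the new element onto `i`. Along this map the iterates of the enlarged permutation
    -- become those of σ, pausing once on each passage through 0.
    contract : Fin (suc n) → Fin n
    contract zero    = i
    contract (suc j) = j

    step : ∀ j → f′ (suc j) ≡ swapIn (suc i) (f j)
    step j = Vec.lookup-map j (swapIn (suc i)) σ

    contract-f′ : ∀ j → contract (f′ (suc j)) ≡ f j
    contract-f′ j rewrite step j with f j Fin.≟ i
    ... | yes fj≡i = sym fj≡i
    ... | no _     = refl

    reaches-contract : ∀ x t → Reaches f (contract x) (contract (iterate f′ x t))
    reaches-contract x       zero    = 0 , refl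
    -- The step from 0 to `suc i` is the pause: both contract to `i`.
    reaches-contract zero    (suc t) = reaches-contract (suc i) t
    reaches-contract (suc j) (suc t) with reaches-contract (f′ (suc j)) t
    ... | s , eq = suc s , trans (cong (λ y → iterate f y s) (sym (contract-f′ j))) eq

    reaches-f : ∀ j → Reaches f′ (suc j) (suc (f j))
    reaches-f j with f j Fin.≟ i | step j
    ... | yes fj≡i | eq = 2 , trans (cong f′ eq) (cong suc (sym fj≡i))
    ... | no _     | eq = 1 , eq

    reaches-suc : ∀ j t → Reaches f′ (suc j) (suc (iterate f j t))
    reaches-suc j zero    = 0 , refl
    reaches-suc j (suc t) = reaches-trans f′ (reaches-f j) (reaches-suc (f j) t)

    reaches-suc-contract : ∀ x → Reaches f′ x (suc (contract x))
    reaches-suc-contract zero    = 1 , refl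
    reaches-suc-contract (suc j) = 0 , refl

    -- Forwards, iterates contract. Backwards, each point is in the same cycle as the `suc` of its
    -- contraction, and a step of σ lifts to one step, or to two through 0.
    reaches-⇔ : ∀ {x y} → Reaches f′ x y ⇔ Reaches f (contract x) (contract y)
    reaches-⇔ {x} {y} = mk⇔ (λ { (t , refl) → reaches-contract x t }) λ (t , eq) →
      reaches-trans f′ (reaches-suc-contract x)
        (reaches-trans f′ (subst (λ z → Reaches f′ (suc (contract x)) (suc z)) eq (reaches-suc (contract x) t))
          (reaches-sym′ (reaches-suc-contract y)))

    -- The preimage of `C` under `contract`.
    enlarge : Subset n → Subset (suc n)
    enlarge C = lookup C i ∷ C

    ∈-enlarge : ∀ {x C} → x ∈ˢ enlarge C ⇔ contract x ∈ˢ C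
    ∈-enlarge {zero}  {C} = mk⇔ (λ x∈ → Vec.lookup⇒[]= i C (Vec.[]=⇒lookup x∈))
                                (λ i∈ → Vec.lookup⇒[]= zero (enlarge C) (Vec.[]=⇒lookup i∈))
    ∈-enlarge {suc j} {C} = mk⇔ (λ { (Vec.there x∈) → x∈ }) Vec.there

    orbit-enlarge : ∀ x → orbit σ′ x ≡ enlarge (orbit σ (contract x))
    orbit-enlarge x = Subset.⊆-antisym
      (from ∈-enlarge ∘ from (∈-orbit (contract x)) ∘ to reaches-⇔ ∘ to (∈-orbit′ x))
      (from (∈-orbit′ x) ∘ from reaches-⇔ ∘ to (∈-orbit (contract x)) ∘ to ∈-enlarge)

    cycles-↭ : cycles σ′ ↭ List.map enlarge (cycles σ)
    cycles-↭ = unique-↭ (cycles-unique σ′) (Unique.map⁺ Vec.∷-injectiveʳ (cycles-unique σ))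
      (λ C → mk⇔ (λ C∈ → forward (to ∈-cycles′ C∈)) backward)
      where
      forward : ∀ {C} → ∃[ x ] C ≡ orbit σ′ x → C ∈ List.map enlarge (cycles σ)
      forward (x , refl) = subst (_∈ _) (sym (orbit-enlarge x))
        (∈-map⁺ enlarge (from ∈-cycles (contract x , refl)))
      backward : ∀ {C} → C ∈ List.map enlarge (cycles σ) → C ∈ cycles σ′
      backward C∈ with ∈-map⁻ enlarge C∈
      ... | C′ , C′∈ , refl with to ∈-cycles C′∈
      ... | j , refl = from ∈-cycles′ (suc j , sym (orbit-enlarge (suc j)))

-- Summation over all permutations by insertion

∑-tabulate-suc : ∀ n (F : Fin (suc n) → ℤ) → ∑ (List.tabulate Fin.suc) F ≡ ∑[ i ← allFin n ] F (suc i)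
∑-tabulate-suc n F = trans (cong (λ is → ∑ is F) (sym (List.map-tabulate {n = n} id Fin.suc)))
  (∑-map Fin.suc (allFin n) F)

∑-const : ∀ n c → ∑[ _ ← allFin n ] c ≡ + n * c
∑-const n c = begin
  ∑[ _ ← allFin n ] c           ≡⟨ ∑-cong (allFin n) (λ _ → sym (ℤ.*-identityʳ c)) ⟩
  ∑[ _ ← allFin n ] (c * 1ℤ)    ≡⟨ ∑-*ˡ (allFin n) c (λ _ → 1ℤ) ⟩
  c * ∑[ _ ← allFin n ] 1ℤ      ≡⟨ cong (c *_) (trans (∑-length (allFin n)) (cong +_ (List.length-tabulate id))) ⟩
  c * + n                       ≡⟨ ℤ.*-comm c (+ n) ⟩
  + n * c                       ∎

∑-indicator : ∀ {n} (C : Subset n) → ∑[ i ← allFin n ] (+ indicator (lookup C i)) ≡ + ∣ C ∣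
∑-indicator []            = refl
∑-indicator {suc n} (b ∷ C) = begin
  + indicator b + ∑ (List.tabulate Fin.suc) (λ i → + indicator (lookup (b ∷ C) i))
    ≡⟨ +-congˡ (+ indicator b) (trans (∑-tabulate-suc n (λ i → + indicator (lookup (b ∷ C) i))) (∑-indicator C)) ⟩
  + indicator b + + ∣ C ∣
    ≡⟨ sym (ℤ.pos-+ (indicator b) ∣ C ∣) ⟩
  + (indicator b ℕ.+ ∣ C ∣)
    ≡⟨ cong +_ (sym (∣∷∣ b C)) ⟩
  + ∣ b ∷ C ∣ ∎

Disjoint : ∀ {n} → Subset n → Subset n → Set
Disjoint C C′ = ∀ i → lookup C i ≡ true → lookup C′ i ≡ false

cycles-disjoint : ∀ {n} (σ : Vec (Fin n) n) → VecUnique.Unique σ → AllPairs Disjoint (cycles σ)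
cycles-disjoint σ σ! = disjoint (cycles-unique σ) (All.tabulate (to ∈-cycles))
  where
  open Orbit σ σ!

  orbits-disjoint : ∀ x y → orbit σ x ≢ orbit σ y → Disjoint (orbit σ x) (orbit σ y)
  orbits-disjoint x y x≢y i i∈x with lookup (orbit σ y) i in i∈y
  ... | false = refl
  ... | true  = contradiction
    (trans (orbit-≡ x (Vec.lookup⇒[]= i _ i∈x)) (sym (orbit-≡ y (Vec.lookup⇒[]= i _ i∈y)))) x≢y

  disjoint : ∀ {𝒞} → Unique 𝒞 → All (λ C → ∃[ x ] C ≡ orbit σ x) 𝒞 → AllPairs Disjoint 𝒞
  disjoint []          []                 = []
  disjoint (C∉ ∷ 𝒞!) ((x , refl) ∷ orbits) =
    All.zipWith (λ { (x≢y , (y , refl)) → orbits-disjoint x y x≢y }) (C∉ , orbits) ∷ disjoint 𝒞! orbits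

sizes : ∀ {n} → List (Subset n) → List ℕ
sizes = List.map ∣_∣

enlargedSizes : ∀ {n} → Fin n → List (Subset n) → List ℕ
enlargedSizes i = List.map (λ C → indicator (lookup C i) ℕ.+ ∣ C ∣)

enlargedSizes-∉ : ∀ {n} (i : Fin n) {𝒞} → All (λ C → lookup C i ≡ false) 𝒞 → enlargedSizes i 𝒞 ≡ sizes 𝒞
enlargedSizes-∉ i []          = refl
enlargedSizes-∉ i (_∷_ {x = C} i∉C i∉𝒞) =
  cong₂ _∷_ (cong (λ b → indicator b ℕ.+ ∣ C ∣) i∉C) (enlargedSizes-∉ i i∉𝒞)

-- The effect of one more element on a colouring with b coloured elements among n: before any of
-- these b it is coloured too, before any of the other n - b it is not.
grow : ℕ → (ℕ → ℤ) → ℕ → ℤ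
grow n f b = (+ n - + b) * f b + + b * f (suc b)

-- Induction on the list of sets. It need not cover all of `Fin n`: an uncovered `i` counts among
-- the n - b uncoloured ones in `grow`. By disjointness, an `i` in the first set changes no other
-- size.
∑-Z-enlarged : ∀ {n} {𝒞 : List (Subset n)} → AllPairs Disjoint 𝒞 → ∀ f →
               ∑[ i ← allFin n ] Z (enlargedSizes i 𝒞) f ≡ Z (sizes 𝒞) (grow n f)
∑-Z-enlarged {n} [] f = trans (∑-const n (f 0)) (lemma (+ n) (f 0) (f 1))
  where
  lemma : ∀ n a b → n * a ≡ (n - 0ℤ) * a + 0ℤ * b
  lemma = solve-∀
∑-Z-enlarged {n} {C ∷ 𝒞} (C∩𝒞 ∷ disj) f = begin
  ∑[ i ← allFin n ] Z (enlargedSizes i 𝒞) (λ b → f b - f (indicator (lookup C i) ℕ.+ ∣ C ∣ ℕ.+ b))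
    ≡⟨ ∑-cong (allFin n) split ⟩
  ∑[ i ← allFin n ] (Z (enlargedSizes i 𝒞) f - (Z (enlargedSizes i 𝒞) g + X * + indicator (lookup C i)))
    ≡⟨ ∑-- (allFin n) (λ i → Z (enlargedSizes i 𝒞) f) _ ⟩
  ∑[ i ← allFin n ] Z (enlargedSizes i 𝒞) f - ∑[ i ← allFin n ] (Z (enlargedSizes i 𝒞) g + X * + indicator (lookup C i))
    ≡⟨ cong₂ _-_ (∑-Z-enlarged disj f) (trans (∑-+ (allFin n) (λ i → Z (enlargedSizes i 𝒞) g) _)
         (cong₂ _+_ (∑-Z-enlarged disj g) (trans (∑-*ˡ (allFin n) X _) (cong (X *_) (∑-indicator C))))) ⟩
  Z L (grow n f) - (Z L (grow n g) + X * + ∣ C ∣)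
    ≡⟨ cong (λ z → Z L (grow n f) - (Z L (grow n g) + z)) (trans (ℤ.*-comm X (+ ∣ C ∣)) (sym (Z-*ˡ L (+ ∣ C ∣) _))) ⟩
  Z L (grow n f) - (Z L (grow n g) + Z L (λ b → + ∣ C ∣ * (g′ b - g b)))
    ≡⟨ cong (λ z → Z L (grow n f) - z) (sym (Z-+ L (grow n g) _)) ⟩
  Z L (grow n f) - Z L (λ b → grow n g b + + ∣ C ∣ * (g′ b - g b))
    ≡⟨ sym (Z-- L (grow n f) _) ⟩
  Z L (λ b → grow n f b - (grow n g b + + ∣ C ∣ * (g′ b - g b)))
    ≡⟨ Z-cong L (λ b → cong (λ z → grow n f b - z) (collect b)) ⟩
  Z L (λ b → grow n f b - grow n f (∣ C ∣ ℕ.+ b)) ∎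
  where
  L = sizes 𝒞
  g g′ : ℕ → ℤ
  g  b = f (∣ C ∣ ℕ.+ b)
  g′ b = f (suc (∣ C ∣ ℕ.+ b))
  X = Z L (λ b → g′ b - g b)

  lemma : ∀ n b c x y → (n - b) * x + b * y + c * (y - x) ≡ (n - (c + b)) * x + (c + b) * y
  lemma = solve-∀

  collect : ∀ b → grow n g b + + ∣ C ∣ * (g′ b - g b) ≡ grow n f (∣ C ∣ ℕ.+ b)
  collect b = begin
    (+ n - + b) * g b + + b * g (suc b) + + ∣ C ∣ * (g′ b - g b)
      ≡⟨ cong (λ z → (+ n - + b) * g b + + b * f z + + ∣ C ∣ * (g′ b - g b)) (ℕ.+-suc ∣ C ∣ b) ⟩
    (+ n - + b) * g b + + b * g′ b + + ∣ C ∣ * (g′ b - g b)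
      ≡⟨ lemma (+ n) (+ b) (+ ∣ C ∣) (g b) (g′ b) ⟩
    (+ n - (+ ∣ C ∣ + + b)) * g b + (+ ∣ C ∣ + + b) * g′ b
      ≡⟨ cong (λ z → (+ n - z) * g b + z * g′ b) (sym (ℤ.pos-+ ∣ C ∣ b)) ⟩
    grow n f (∣ C ∣ ℕ.+ b) ∎

  a+0≡ : ∀ a x → a ≡ a + x * 0ℤ
  a+0≡ = solve-∀
  a≡b+ : ∀ a b → a ≡ b + (a - b) * 1ℤ
  a≡b+ = solve-∀

  shifted : ∀ i → Z (enlargedSizes i 𝒞) (λ b → f (indicator (lookup C i) ℕ.+ ∣ C ∣ ℕ.+ b)) ≡
                  Z (enlargedSizes i 𝒞) g + X * + indicator (lookup C i)
  shifted i with lookup C i in i∈C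
  ... | false = a+0≡ _ X
  -- The remaining sizes are the old ones here, so the correction `X` does not depend on `i` and
  -- occurs once for each element of `C`.
  ... | true rewrite enlargedSizes-∉ i (All.map (λ disj → disj i i∈C) C∩𝒞) =
    trans (a≡b+ (Z L g′) (Z L g)) (cong (λ z → Z L g + z * 1ℤ) (sym (Z-- L g′ g)))

  split : ∀ i → Z (enlargedSizes i 𝒞) (λ b → f b - f (indicator (lookup C i) ℕ.+ ∣ C ∣ ℕ.+ b)) ≡
                Z (enlargedSizes i 𝒞) f - (Z (enlargedSizes i 𝒞) g + X * + indicator (lookup C i))
  split i = trans (Z-- (enlargedSizes i 𝒞) f _) (cong (λ z → Z (enlargedSizes i 𝒞) f - z) (shifted i))

weigh : (u v : ℕ → ℤ) → ℕ → ℕ → ℤ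
weigh u v r b = u b * v b ^ r

-- In the application `u b` is the cut-off at b ≤ k and `v b` is (k - b) t, so this is t^(r-1) times
-- the contribution of a permutation with r cycles. General `u` and `v` are needed because an
-- insertion replaces them by other sequences.
ζ : (u v : ℕ → ℤ) → List ℕ → ℤ
ζ u v L = Z L (weigh u v (pred (length L)))

ζ-↭ : ∀ u v {L L′} → L ↭ L′ → ζ u v L ≡ ζ u v L′
ζ-↭ u v {L} {L′} L↭L′ = trans (Z-↭ L↭L′ _) (cong (λ r → Z L′ (weigh u v (pred r))) (Perm.↭-length L↭L′))

sizes-fixed : ∀ {n} (σ : Vec (Fin n) n) → VecUnique.Unique σ →
              sizes (cycles (insert zero σ)) ↭ 1 ∷ sizes (cycles σ)
sizes-fixed {n} σ σ! = ↭-trans (Perm.map⁺ ∣_∣ cycles-↭)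
  (↭-reflexive (cong₂ _∷_ (cong suc (Subset.∣⊥∣≡0 n)) (sym (List.map-∘ (cycles σ)))))
  where open Insert.Fixed σ σ!

sizes-before : ∀ {n} (σ : Vec (Fin n) n) → VecUnique.Unique σ → ∀ i →
               sizes (cycles (insert (suc i) σ)) ↭ enlargedSizes i (cycles σ)
sizes-before σ σ! i = ↭-trans (Perm.map⁺ ∣_∣ cycles-↭)
  (↭-reflexive (trans (sym (List.map-∘ (cycles σ))) (List.map-cong (λ C → ∣∷∣ (lookup C i) C) (cycles σ))))
  where open Insert.Before σ σ! i

-- A new fixed point brings a factor 1 - S and one more power of `v`; the other insertions bring
-- `grow`. Collecting the values at b and at b + 1 separately restores the form `weigh`, once with
-- new `u` and once with new `u` and shifted `v`.
Z-weigh : ∀ L n u v r →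
  Z L (λ b → weigh u v (suc r) b - weigh u v (suc r) (suc b)) + Z L (grow n (weigh u v r)) ≡
  Z L (weigh (λ b → u b * (v b + (+ n - + b))) v r) +
  Z L (weigh (λ b → u (suc b) * (+ b - v (suc b))) (v ∘ suc) r)
Z-weigh L n u v r = begin
  Z L (λ b → weigh u v (suc r) b - weigh u v (suc r) (suc b)) + Z L (grow n (weigh u v r))
    ≡⟨ sym (Z-+ L (λ b → weigh u v (suc r) b - weigh u v (suc r) (suc b)) (grow n (weigh u v r))) ⟩
  Z L (λ b → weigh u v (suc r) b - weigh u v (suc r) (suc b) + grow n (weigh u v r) b)
    ≡⟨ Z-cong L (λ b → lemma (u b) (v b) (v b ^ r) (u (suc b)) (v (suc b)) (v (suc b) ^ r) (+ n) (+ b)) ⟩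
  Z L (λ b → weigh u₁ v r b + weigh u₂ (v ∘ suc) r b)
    ≡⟨ Z-+ L (weigh u₁ v r) (weigh u₂ (v ∘ suc) r) ⟩
  Z L (weigh u₁ v r) + Z L (weigh u₂ (v ∘ suc) r) ∎
  where
  u₁ u₂ : ℕ → ℤ
  u₁ b = u b * (v b + (+ n - + b))
  u₂ b = u (suc b) * (+ b - v (suc b))
  lemma : ∀ u v x u′ v′ x′ n b →
          u * (v * x) - u′ * (v′ * x′) + ((n - b) * (u * x) + b * (u′ * x′)) ≡
          u * (v + (n - b)) * x + u′ * (b - v′) * x′
  lemma = solve-∀

∑-insert : ∀ m (σ : Vec (Fin (suc m)) (suc m)) → VecUnique.Unique σ → ∀ u v →
  ∑[ c ← allFin (suc (suc m)) ] ζ u v (sizes (cycles (insert c σ))) ≡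
  ζ (λ b → u b * (v b + (+ suc m - + b))) v (sizes (cycles σ)) +
  ζ (λ b → u (suc b) * (+ b - v (suc b))) (v ∘ suc) (sizes (cycles σ))
∑-insert m σ σ! u v = begin
  F zero + ∑ (List.tabulate Fin.suc) F
    ≡⟨ cong₂ _+_ (ζ-↭ u v (sizes-fixed σ σ!))
         (trans (∑-tabulate-suc (suc m) F) (∑-cong (allFin (suc m)) before)) ⟩
  Z L (λ b → weigh u v (suc r) b - weigh u v (suc r) (suc b)) + ∑[ i ← allFin (suc m) ] Z (enlargedSizes i (cycles σ)) (weigh u v r)
    ≡⟨ +-congˡ (Z L (λ b → weigh u v (suc r) b - weigh u v (suc r) (suc b)))
         (∑-Z-enlarged (cycles-disjoint σ σ!) (weigh u v r)) ⟩
  Z L (λ b → weigh u v (suc r) b - weigh u v (suc r) (suc b)) + Z L (grow (suc m) (weigh u v r))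
    ≡⟨ Z-weigh L (suc m) u v r ⟩
  ζ (λ b → u b * (v b + (+ suc m - + b))) v L + ζ (λ b → u (suc b) * (+ b - v (suc b))) (v ∘ suc) L ∎
  where
  L = sizes (cycles σ)
  -- On a nonempty set `cycles σ` reduces to a cons, so `length L` is `suc r` by computation.
  r = pred (length L)
  F : Fin (suc (suc m)) → ℤ
  F c = ζ u v (sizes (cycles (insert c σ)))
  before : ∀ i → F (suc i) ≡ Z (enlargedSizes i (cycles σ)) (weigh u v r)
  before i = trans (ζ-↭ u v (sizes-before σ σ! i))
    (cong (λ r → Z (enlargedSizes i (cycles σ)) (weigh u v (pred r)))
      (trans (List.length-map _ (cycles σ)) (sym (List.length-map ∣_∣ (cycles σ)))))

-- Expanding ∏_c (1 - z^|c|) colours some cycles of σ, each with sign -1; j counts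
-- the elements in coloured cycles.
∑-perms : ∀ m u v → ∑[ σ ← perms (suc m) ] ζ u v (sizes (cycles σ)) ≡
          D (suc m) (λ j → u j * rising m (v j - + j))
∑-perms zero    u v = ℤ.+-identityʳ _
∑-perms (suc m) u v = begin
  ∑[ σ ← perms (suc (suc m)) ] ζ u v (sizes (cycles σ))
    ≡⟨ ∑-bind insert (allFin (suc (suc m))) (λ _ → perms (suc m)) _ ⟩
  ∑[ c ← allFin (suc (suc m)) ] ∑[ σ ← perms (suc m) ] ζ u v (sizes (cycles (insert c σ)))
    ≡⟨ ∑-swap (allFin (suc (suc m))) (perms (suc m)) _ ⟩
  ∑[ σ ← perms (suc m) ] ∑[ c ← allFin (suc (suc m)) ] ζ u v (sizes (cycles (insert c σ)))
    ≡⟨ ∑-cong-∈ (perms (suc m)) (λ {σ} σ∈ → ∑-insert m σ (to (proj₂ (enumerates-perms (suc m)) σ) σ∈) u v) ⟩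
  ∑[ σ ← perms (suc m) ] (ζ u₁ v (sizes (cycles σ)) + ζ u₂ (v ∘ suc) (sizes (cycles σ)))
    ≡⟨ ∑-+ (perms (suc m)) _ _ ⟩
  ∑[ σ ← perms (suc m) ] ζ u₁ v (sizes (cycles σ)) + ∑[ σ ← perms (suc m) ] ζ u₂ (v ∘ suc) (sizes (cycles σ))
    ≡⟨ cong₂ _+_ (∑-perms m u₁ v) (∑-perms m u₂ (v ∘ suc)) ⟩
  D (suc m) (λ j → u₁ j * rising m (v j - + j)) + D (suc m) (λ j → u₂ j * rising m (v (suc j) - + j))
    ≡⟨ D-risinging-step m u v ⟩
  D (suc (suc m)) (λ j → u j * rising (suc m) (v j - + j)) ∎
  where
  u₁ u₂ : ℕ → ℤ
  u₁ b = u b * (v b + (+ suc m - + b))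
  u₂ b = u (suc b) * (+ b - v (suc b))

-- Polynomials over ℚ

toℚᵘ-fromℤ : ∀ a → toℚᵘ (fromℤ a) ℚᵘ.≃ mkℚᵘ a 0
toℚᵘ-fromℤ a = ℚ.toℚᵘ-fromℚᵘ (mkℚᵘ a 0)

fromℤ-homo-+ : ∀ a b → fromℤ (a ℤ.+ b) ≡ fromℤ a ℚ.+ fromℤ b
fromℤ-homo-+ a b = ℚ.toℚᵘ-injective (ℚᵘ.≃-trans (toℚᵘ-fromℤ (a ℤ.+ b)) (ℚᵘ.≃-trans
  (*≡* (cong (ℤ._* + 1) (sym (cong₂ ℤ._+_ (ℤ.*-identityʳ a) (ℤ.*-identityʳ b)))))
  (ℚᵘ.≃-sym (ℚᵘ.≃-trans (ℚ.toℚᵘ-homo-+ (fromℤ a) (fromℤ b))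
    (ℚᵘ.+-cong (toℚᵘ-fromℤ a) (toℚᵘ-fromℤ b))))))

fromℤ-homo-* : ∀ a b → fromℤ (a ℤ.* b) ≡ fromℤ a ℚ.* fromℤ b
fromℤ-homo-* a b = ℚ.toℚᵘ-injective (ℚᵘ.≃-trans (toℚᵘ-fromℤ (a ℤ.* b)) (ℚᵘ.≃-trans
  (*≡* refl)
  (ℚᵘ.≃-sym (ℚᵘ.≃-trans (ℚ.toℚᵘ-homo-* (fromℤ a) (fromℤ b))
    (ℚᵘ.*-cong (toℚᵘ-fromℤ a) (toℚᵘ-fromℤ b))))))

fromℤ-mono-≤ : ∀ {a b} → a ℤ.≤ b → fromℤ a ℚ.≤ fromℤ b
fromℤ-mono-≤ {a} {b} a≤b = ℚ.toℚᵘ-cancel-≤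
  (ℚᵘ.≤-respʳ-≃ (ℚᵘ.≃-sym (toℚᵘ-fromℤ b)) (ℚᵘ.≤-respˡ-≃ (ℚᵘ.≃-sym (toℚᵘ-fromℤ a))
    (*≤* (subst₂ ℤ._≤_ (sym (ℤ.*-identityʳ a)) (sym (ℤ.*-identityʳ b)) a≤b))))

fromℤ-cancel-≤ : ∀ {a b} → fromℤ a ℚ.≤ fromℤ b → a ℤ.≤ b
fromℤ-cancel-≤ {a} {b} a≤b
  with ℚᵘ.≤-respʳ-≃ (toℚᵘ-fromℤ b) (ℚᵘ.≤-respˡ-≃ (toℚᵘ-fromℤ a) (ℚ.toℚᵘ-mono-≤ a≤b))
... | *≤* a≤b′ = subst₂ ℤ._≤_ (ℤ.*-identityʳ a) (ℤ.*-identityʳ b) a≤b′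

fromℤ-injective : ∀ {a b} → fromℤ a ≡ fromℤ b → a ≡ b
fromℤ-injective eq = ℤ.≤-antisym (fromℤ-cancel-≤ (ℚ.≤-reflexive eq)) (fromℤ-cancel-≤ (ℚ.≤-reflexive (sym eq)))

fromℕ-injective : ∀ {a b} → fromℕ a ≡ fromℕ b → a ≡ b
fromℕ-injective = ℤ.+-injective ∘ fromℤ-injective

fromℕ-nonZero : ∀ n .{{_ : ℕ.NonZero n}} → NonZero (fromℕ n)
fromℕ-nonZero (suc n) = ≢-nonZero λ eq → ℕ.1+n≢0 (fromℕ-injective {suc n} {0} eq)

*-cancel-0 : ∀ p q .{{_ : NonZero p}} → p ℚ.* q ≡ 0ℚ → q ≡ 0ℚ
*-cancel-0 p q pq≡0 = begin
  q                    ≡⟨ sym (ℚ.*-identityˡ q) ⟩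
  1ℚ ℚ.* q             ≡⟨ cong (ℚ._* q) (sym (ℚ.*-inverseˡ p)) ⟩
  1/ p ℚ.* p ℚ.* q     ≡⟨ ℚ.*-assoc (1/ p) p q ⟩
  1/ p ℚ.* (p ℚ.* q)   ≡⟨ cong (1/ p ℚ.*_) pq≡0 ⟩
  1/ p ℚ.* 0ℚ          ≡⟨ ℚ.*-zeroʳ (1/ p) ⟩
  0ℚ                   ∎

infixl 6 _⊕_

_⊕_ : Polynomial → Polynomial → Polynomial
[]      ⊕ g       = g
(a ∷ f) ⊕ []      = a ∷ f
(a ∷ f) ⊕ (b ∷ g) = (a ℚ.+ b) ∷ (f ⊕ g)

coeff-⊕ : ∀ f g m → coeff (f ⊕ g) m ≡ coeff f m ℚ.+ coeff g m
coeff-⊕ []      g       m       = sym (ℚ.+-identityˡ _)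
coeff-⊕ (a ∷ f) []      m       = sym (ℚ.+-identityʳ _)
coeff-⊕ (a ∷ f) (b ∷ g) zero    = refl
coeff-⊕ (a ∷ f) (b ∷ g) (suc m) = coeff-⊕ f g m

eval-⊕ : ∀ f g t → eval (f ⊕ g) t ≡ eval f t ℚ.+ eval g t
eval-⊕ []      g       t = sym (ℚ.+-identityˡ _)
eval-⊕ (a ∷ f) []      t = sym (ℚ.+-identityʳ _)
eval-⊕ (a ∷ f) (b ∷ g) t = trans (cong (λ e → a ℚ.+ b ℚ.+ t ℚ.* e) (eval-⊕ f g t))
  (solve 5 (λ a b t x y → a :+ b :+ t :* (x :+ y) := a :+ t :* x :+ (b :+ t :* y)) refl
    a b t (eval f t) (eval g t))

length-⊕ : ∀ f g → length (f ⊕ g) ≡ length f ℕ.⊔ length g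
length-⊕ []      g       = refl
length-⊕ (a ∷ f) []      = refl
length-⊕ (a ∷ f) (b ∷ g) = cong suc (length-⊕ f g)

coeff-· : ∀ q f m → coeff (q · f) m ≡ q ℚ.* coeff f m
coeff-· q []      m       = sym (ℚ.*-zeroʳ q)
coeff-· q (a ∷ f) zero    = refl
coeff-· q (a ∷ f) (suc m) = coeff-· q f m

eval-· : ∀ q f t → eval (q · f) t ≡ q ℚ.* eval f t
eval-· q []      t = sym (ℚ.*-zeroʳ q)
eval-· q (a ∷ f) t = trans (cong (λ e → q ℚ.* a ℚ.+ t ℚ.* e) (eval-· q f t))
  (solve 4 (λ q a t x → q :* a :+ t :* (q :* x) := q :* (a :+ t :* x)) refl q a t (eval f t))

eval-0 : ∀ f t → (∀ m → coeff f m ≡ 0ℚ) → eval f t ≡ 0ℚ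
eval-0 []      t f≡0 = refl
eval-0 (a ∷ f) t f≡0 = trans
  (cong₂ (λ x y → x ℚ.+ t ℚ.* y) (f≡0 0) (eval-0 f t (f≡0 ∘ suc)))
  (trans (ℚ.+-identityˡ _) (ℚ.*-zeroʳ t))

-- (f(x) - f(a)) / (x - a)
quotient : ℚ → Polynomial → Polynomial
quotient a []      = []
quotient a (c ∷ f) = f ⊕ a · quotient a f

length-quotient : ∀ a f → length (quotient a f) ≡ ℕ.pred (length f)
length-quotient a []      = refl
length-quotient a (c ∷ f) = begin
  length (f ⊕ a · quotient a f)              ≡⟨ length-⊕ f _ ⟩
  length f ℕ.⊔ length (a · quotient a f)     ≡⟨ cong (length f ℕ.⊔_) (trans (List.length-map _ (quotient a f)) (length-quotient a f)) ⟩
  length f ℕ.⊔ ℕ.pred (length f)             ≡⟨ ℕ.m≥n⇒m⊔n≡m ℕ.pred[n]≤n ⟩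
  length f                                   ∎

eval-quotient : ∀ a f x → (x ℚ.- a) ℚ.* eval (quotient a f) x ≡ eval f x ℚ.- eval f a
eval-quotient a []      x = ℚ.*-zeroʳ (x ℚ.- a)
eval-quotient a (c ∷ f) x = begin
  (x ℚ.- a) ℚ.* eval (f ⊕ a · quotient a f) x
    ≡⟨ cong ((x ℚ.- a) ℚ.*_) (trans (eval-⊕ f (a · quotient a f) x) (cong (eval f x ℚ.+_) (eval-· a (quotient a f) x))) ⟩
  (x ℚ.- a) ℚ.* (eval f x ℚ.+ a ℚ.* eval (quotient a f) x)
    ≡⟨ solve 4 (λ x a f q → (x :- a) :* (f :+ a :* q) := (x :- a) :* f :+ a :* ((x :- a) :* q)) refl
         x a (eval f x) (eval (quotient a f) x) ⟩
  (x ℚ.- a) ℚ.* eval f x ℚ.+ a ℚ.* ((x ℚ.- a) ℚ.* eval (quotient a f) x)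
    ≡⟨ cong (λ e → (x ℚ.- a) ℚ.* eval f x ℚ.+ a ℚ.* e) (eval-quotient a f x) ⟩
  (x ℚ.- a) ℚ.* eval f x ℚ.+ a ℚ.* (eval f x ℚ.- eval f a)
    ≡⟨ solve 5 (λ x a f g c → (x :- a) :* f :+ a :* (f :- g) := (c :+ x :* f) :- (c :+ a :* g)) refl
         x a (eval f x) (eval f a) c ⟩
  (c ℚ.+ x ℚ.* eval f x) ℚ.- (c ℚ.+ a ℚ.* eval f a) ∎

coeff-quotient : ∀ a f m → coeff (quotient a f) m ≡ coeff f (suc m) ℚ.+ a ℚ.* coeff (quotient a f) (suc m)
coeff-quotient a []      m = sym (trans (ℚ.+-identityˡ _) (ℚ.*-zeroʳ a))
coeff-quotient a (c ∷ f) m = begin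
  coeff (f ⊕ a · quotient a f) m
    ≡⟨ trans (coeff-⊕ f _ m) (cong (coeff f m ℚ.+_) (coeff-· a (quotient a f) m)) ⟩
  coeff f m ℚ.+ a ℚ.* coeff (quotient a f) m
    ≡⟨ cong (λ e → coeff f m ℚ.+ a ℚ.* e) (coeff-quotient a f m) ⟩
  coeff f m ℚ.+ a ℚ.* (coeff f (suc m) ℚ.+ a ℚ.* coeff (quotient a f) (suc m))
    ≡⟨ cong (λ e → coeff f m ℚ.+ a ℚ.* e) (sym (trans (coeff-⊕ f _ (suc m)) (cong (coeff f (suc m) ℚ.+_) (coeff-· a (quotient a f) (suc m))))) ⟩
  coeff f m ℚ.+ a ℚ.* coeff (f ⊕ a · quotient a f) (suc m) ∎

-- Splitting off the root s leaves a shorter polynomial that vanishes from s + 1 on. Its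
-- coefficients are 0 by induction, so those of `f` above the constant term are, and f(s) = 0
-- settles the constant. The bound `n` carries the recursion, as the quotient is no sublist of `f`.
vanishing : ∀ n f → length f ℕ.≤ n → ∀ s → (∀ t → s ℕ.≤ t → eval f (fromℕ t) ≡ 0ℚ) →
            ∀ m → coeff f m ≡ 0ℚ
vanishing n       []      _           s f≡0 m = refl
vanishing (suc n) (c ∷ f) (s≤s ∣f∣≤n) s f≡0 = λ { zero → constant ; (suc m) → higher m }
  where
  a = fromℕ s
  h = quotient a (c ∷ f)

  h≡0 : ∀ t → suc s ℕ.≤ t → eval h (fromℕ t) ≡ 0ℚ
  h≡0 t s<t = *-cancel-0 (fromℕ t ℚ.- a) (eval h (fromℕ t)) {{≢-nonZero t≢s}} (begin
    (fromℕ t ℚ.- a) ℚ.* eval h (fromℕ t)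
      ≡⟨ eval-quotient a (c ∷ f) (fromℕ t) ⟩
    eval (c ∷ f) (fromℕ t) ℚ.- eval (c ∷ f) a
      ≡⟨ cong₂ ℚ._-_ (f≡0 t (ℕ.<⇒≤ s<t)) (f≡0 s ℕ.≤-refl) ⟩
    0ℚ ∎)
    where
    t≢s : fromℕ t ℚ.- a ≢ 0ℚ
    t≢s eq = ℕ.<⇒≢ s<t (sym (fromℕ-injective (begin
      fromℕ t                   ≡⟨ solve 2 (λ t a → t := (t :- a) :+ a) refl (fromℕ t) a ⟩
      (fromℕ t ℚ.- a) ℚ.+ a     ≡⟨ cong (ℚ._+ a) eq ⟩
      0ℚ ℚ.+ a                  ≡⟨ ℚ.+-identityˡ a ⟩
      a                         ∎)))

  h-coeff : ∀ m → coeff h m ≡ 0ℚ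
  h-coeff = vanishing n h (subst (ℕ._≤ n) (sym (length-quotient a (c ∷ f))) ∣f∣≤n) (suc s) h≡0

  higher : ∀ m → coeff f m ≡ 0ℚ
  higher m = begin
    coeff f m                                     ≡⟨ sym (ℚ.+-identityʳ _) ⟩
    coeff f m ℚ.+ 0ℚ                              ≡⟨ cong (coeff f m ℚ.+_) (sym (trans (cong (a ℚ.*_) (h-coeff (suc m))) (ℚ.*-zeroʳ a))) ⟩
    coeff f m ℚ.+ a ℚ.* coeff h (suc m)           ≡⟨ sym (coeff-quotient a (c ∷ f) m) ⟩
    coeff h m                                     ≡⟨ h-coeff m ⟩
    0ℚ                                            ∎

  constant : c ≡ 0ℚ
  constant = begin
    c                            ≡⟨ sym (ℚ.+-identityʳ c) ⟩
    c ℚ.+ 0ℚ                     ≡⟨ cong (c ℚ.+_) (sym (trans (cong (a ℚ.*_) (eval-0 f a higher)) (ℚ.*-zeroʳ a))) ⟩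
    c ℚ.+ a ℚ.* eval f a         ≡⟨ f≡0 s ℕ.≤-refl ⟩
    0ℚ                           ∎

eval-injective : ∀ f g → (∀ t .{{_ : ℕ.NonZero t}} → eval f (fromℕ t) ≡ eval g (fromℕ t)) →
                 ∀ m → coeff f m ≡ coeff g m
eval-injective f g f≡g m = begin
  coeff f m                                            ≡⟨ solve 2 (λ x y → x := (x :+ (:- con 1ℚ) :* y) :+ y) refl (coeff f m) (coeff g m) ⟩
  (coeff f m ℚ.+ ℚ.- 1ℚ ℚ.* coeff g m) ℚ.+ coeff g m    ≡⟨ cong (ℚ._+ coeff g m) (sym (trans (coeff-⊕ f _ m) (cong (coeff f m ℚ.+_) (coeff-· (ℚ.- 1ℚ) g m)))) ⟩
  coeff h m ℚ.+ coeff g m                              ≡⟨ cong (ℚ._+ coeff g m) (vanishing (length h) h ℕ.≤-refl 1 h≡0 m) ⟩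
  0ℚ ℚ.+ coeff g m                                     ≡⟨ ℚ.+-identityˡ _ ⟩
  coeff g m                                            ∎
  where
  h = f ⊕ (ℚ.- 1ℚ) · g
  h≡0 : ∀ t → 1 ℕ.≤ t → eval h (fromℕ t) ≡ 0ℚ
  h≡0 t@(suc _) _ = begin
    eval h (fromℕ t)                                            ≡⟨ trans (eval-⊕ f _ (fromℕ t)) (cong (eval f (fromℕ t) ℚ.+_) (eval-· (ℚ.- 1ℚ) g (fromℕ t))) ⟩
    eval f (fromℕ t) ℚ.+ ℚ.- 1ℚ ℚ.* eval g (fromℕ t)             ≡⟨ cong (ℚ._+ ℚ.- 1ℚ ℚ.* eval g (fromℕ t)) (f≡g t) ⟩
    eval g (fromℕ t) ℚ.+ ℚ.- 1ℚ ℚ.* eval g (fromℕ t)             ≡⟨ solve 1 (λ x → x :+ (:- con 1ℚ) :* x := con 0ℚ) refl (eval g (fromℕ t)) ⟩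
    0ℚ                                                          ∎

coeff-applyUpTo : ∀ (c : ℕ → ℚ) {n m} → m ℕ.< n → coeff (applyUpTo c n) m ≡ c m
coeff-applyUpTo c {suc n} {zero}  _         = refl
coeff-applyUpTo c {suc n} {suc m} (s≤s m<n) = coeff-applyUpTo (c ∘ suc) m<n

eval-applyUpTo : ∀ (c : ℕ → ℤ) n t → eval (applyUpTo (fromℤ ∘ c) n) (fromℤ t) ≡
                 fromℤ (∑[ m ← upTo n ] (t ℤ.^ m ℤ.* c m))
eval-applyUpTo c zero    t = refl
eval-applyUpTo c (suc n) t = begin
  fromℤ (c 0) ℚ.+ fromℤ t ℚ.* eval (applyUpTo (fromℤ ∘ c ∘ suc) n) (fromℤ t)
    ≡⟨ cong (λ e → fromℤ (c 0) ℚ.+ fromℤ t ℚ.* e) (eval-applyUpTo (c ∘ suc) n t) ⟩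
  fromℤ (c 0) ℚ.+ fromℤ t ℚ.* fromℤ (∑[ m ← upTo n ] (t ℤ.^ m ℤ.* c (suc m)))
    ≡⟨ cong (fromℤ (c 0) ℚ.+_) (sym (fromℤ-homo-* t _)) ⟩
  fromℤ (c 0) ℚ.+ fromℤ (t ℤ.* ∑[ m ← upTo n ] (t ℤ.^ m ℤ.* c (suc m)))
    ≡⟨ sym (fromℤ-homo-+ (c 0) _) ⟩
  fromℤ (c 0 ℤ.+ t ℤ.* ∑[ m ← upTo n ] (t ℤ.^ m ℤ.* c (suc m)))
    ≡⟨ cong fromℤ (cong₂ ℤ._+_ (sym (ℤ.*-identityˡ (c 0)))
         (trans (sym (∑-*ˡ (upTo n) t _)) (∑-cong (upTo n) (λ m → sym (ℤ.*-assoc t (t ℤ.^ m) (c (suc m))))))) ⟩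
  fromℤ (t ℤ.^ 0 ℤ.* c 0 ℤ.+ ∑[ m ← upTo n ] (t ℤ.^ suc m ℤ.* c (suc m)))
    ≡⟨ cong fromℤ (sym (∑-upTo n (λ m → t ℤ.^ m ℤ.* c m))) ⟩
  fromℤ (∑[ m ← upTo (suc n) ] (t ℤ.^ m ℤ.* c m)) ∎

-- Counting

does-∈? : ∀ {n} (i : Fin n) (C : Subset n) → does (i ∈? C) ≡ lookup C i
does-∈? zero    (true  ∷ C) = refl
does-∈? zero    (false ∷ C) = refl
does-∈? (suc i) (b ∷ C)     = does-∈? i C

sum-const-1 : ∀ {A : Set} (f : A → ℕ) → (∀ x → f x ≡ 1) → ∀ xs → ℕ.sum (List.map f xs) ≡ length xs
sum-const-1 f f≡1 []       = refl
sum-const-1 f f≡1 (x ∷ xs) = cong₂ ℕ._+_ (f≡1 x) (sum-const-1 f f≡1 xs)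

sumOver-1 : ∀ {n} (C : Subset n) → sumOver C (replicate n 1) ≡ ∣ C ∣
sumOver-1 {n} C = trans
  (sum-const-1 (lookup (replicate n 1)) (λ i → Vec.lookup-replicate i 1) (filter (_∈? C) (allFin n)))
  (ℤ.+-injective (begin
    + length (filter (_∈? C) (allFin n))                     ≡⟨ ∑-filter (_∈? C) (allFin n) ⟩
    ∑[ i ← allFin n ] (if does (i ∈? C) then 1ℤ else 0ℤ)     ≡⟨ ∑-cong (allFin n) (λ i → trans
                                                                  (cong (if_then 1ℤ else 0ℤ) (does-∈? i C)) (coerce (lookup C i))) ⟩
    ∑[ i ← allFin n ] (+ indicator (lookup C i))             ≡⟨ ∑-indicator C ⟩
    + ∣ C ∣                                                  ∎))
  where
  coerce : ∀ b → (if b then 1ℤ else 0ℤ) ≡ + indicator b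
  coerce true  = refl
  coerce false = refl

cycleSizes : ∀ {n} (σ : Vec (Fin n) n) → Vec ℕ (length (cycles σ))
cycleSizes σ = Vec.map ∣_∣ (Vec.fromList (cycles σ))

toList-cycleSizes : ∀ {n} (σ : Vec (Fin n) n) → Vec.toList (cycleSizes σ) ≡ sizes (cycles σ)
toList-cycleSizes σ = trans (Vec.toList-map ∣_∣ (Vec.fromList (cycles σ)))
  (cong (List.map ∣_∣) (Vec.toList∘fromList (cycles σ)))

lookup-fromList : ∀ {A : Set} (xs : List A) i → lookup (Vec.fromList xs) i ≡ List.lookup xs i
lookup-fromList (x ∷ xs) zero    = refl
lookup-fromList (x ∷ xs) (suc i) = lookup-fromList xs i

lookup-cycleSizes : ∀ {n} (σ : Vec (Fin n) n) i →
                    lookup (cycleSizes σ) i ≡ sumOver (List.lookup (cycles σ) i) (replicate n 1)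
lookup-cycleSizes σ i = trans (Vec.lookup-map i ∣_∣ (Vec.fromList (cycles σ)))
  (trans (cong ∣_∣ (lookup-fromList (cycles σ) i)) (sym (sumOver-1 (List.lookup (cycles σ) i))))

-- Counting the triples

module _ {n : ℕ} where

  private
    COWP = CycleOrderedWeightedPermutation n

  Labels : Vec (Fin n) n → Set
  Labels σ = Vec (Fin (length (cycles σ))) (length (cycles σ)) × Vec ℕ (length (cycles σ))

  -- The proofs are split off from the data, so that nested pairs, which `bind` can list, stand for
  -- the triples.
  Admissible : Pred (Σ (Vec (Fin n) n) Labels) 0ℓ
  Admissible (σ , p , w) = VecUnique.Unique σ × (VecUnique.Unique p × LastZero p) ×
    (∀ i → lookup w i < lookup (cycleSizes σ) i)

  labels : ∀ σ → List (Labels σ)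
  labels σ = bind _,_ (lastZero (length (cycles σ))) (λ _ → box (cycleSizes σ))

  admissible : List (Σ (Vec (Fin n) n) Labels)
  admissible = bind _,_ (perms n) labels

  enumerates-admissible : Enumerates Admissible admissible
  enumerates-admissible = enumerates-bind _,_ id (enumerates-perms n)
    (λ {σ} _ → enumerates-bind _,_ id (enumerates-lastZero (length (cycles σ)))
      (λ _ → enumerates-box (cycleSizes σ)) _,_ (λ { {p , w} (Pp , Pw) → p , w , Pp , Pw , refl }))
    _,_ (λ { {σ , pw} (Pσ , Ppw) → σ , pw , Pσ , Ppw , refl })

  module _ (m k : ℕ) where

    OfType : Pred (Σ (Vec (Fin n) n) Labels) 0ℓ
    OfType (σ , p , w) = length (cycles σ) ≡ suc m × k ≡ Vec.sum w ℕ.+ des p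

    ofType? : Decidable OfType
    ofType? (σ , p , w) = (length (cycles σ) ℕ.≟ suc m) ×-dec (k ℕ.≟ Vec.sum w ℕ.+ des p)

    count : ℕ
    count = length (filter ofType? admissible)

    private
      proj : COWP → Σ (Vec (Fin n) n) Labels
      proj x = σ , p , w
        where open CycleOrderedWeightedPermutation x

      proj-inj : ∀ {x y} → proj x ≡ proj y → x ≡ y
      proj-inj {mk _ _ _ _ _ _} {mk _ _ _ _ _ _} refl = refl

      unique? : ∀ {l s} (v : Vec (Fin l) s) → Dec (VecUnique.Unique v)
      unique? = allPairs? (λ i j → ¬? (i Fin.≟ j))

      P⇒R : ∀ {x} → (Compatible (replicate n 1) ∩ HasType n (suc m) k) x → (Admissible ∩ OfType) (proj x)
      P⇒R {mk σ p w σ! p! p-last} (comp , type) =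
        -- The fields are irrelevant, but decidable, so that relevant proofs can be recomputed.
        (recompute (unique? σ) σ! ,
         (recompute (unique? p) p! , λ i i-last → recompute (toℕ (lookup p i) ℕ.≟ 0) (p-last i i-last)) ,
         λ i → subst (lookup w i <_) (sym (lookup-cycleSizes σ i)) (comp i)) , type

      R⇒P : ∀ {c} → (Admissible ∩ OfType) c →
            ∃[ x ] (Compatible (replicate n 1) ∩ HasType n (suc m) k) x × proj x ≡ c
      R⇒P {σ , p , w} ((σ! , (p! , p-last) , bounded) , type) =
        mk σ p w σ! p! p-last ,
        ((λ i → subst (lookup w i <_) (lookup-cycleSizes σ i) (bounded i)) , type) , refl

    cardinality-count : HasCardinality (Compatible (replicate n 1) ∩ HasType n (suc m) k) count
    cardinality-count = cardinality-lift proj proj-inj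
      (λ {x} → P⇒R {x}) R⇒P (enumerates-filter ofType? enumerates-admissible)

-- Worpitzky's identity supplies the factor (1 - z)^(r+1) that `∑-box` needs to turn the weights
-- into ∏ (1 - z^ℓ).
∑-labels : ∀ {r} (L : Vec ℕ (suc r)) k →
  ∑[ p ← lastZero (suc r) ] ∑[ w ← box L ] at δ₀ k (Vec.sum w ℕ.+ des p) ≡
  Z (Vec.toList L) (at (λ a → (+ a) ^ r) k)
∑-labels {r} L k = begin
  ∑[ p ← lastZero (suc r) ] ∑[ w ← box L ] at δ₀ k (Vec.sum w ℕ.+ des p)
    ≡⟨ ∑-swap (lastZero (suc r)) (box L) (λ p w → at δ₀ k (Vec.sum w ℕ.+ des p)) ⟩
  ∑[ w ← box L ] ∑[ p ← lastZero (suc r) ] at δ₀ k (Vec.sum w ℕ.+ des p)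
    ≡⟨ ∑-cong (box L) (λ w → ∑-lastZero r k (Vec.sum w)) ⟩
  ∑[ w ← box L ] D (suc r) (λ j → at (λ a → (+ a) ^ r) k (Vec.sum w ℕ.+ j))
    ≡⟨ ∑-box L (at (λ a → (+ a) ^ r) k) ⟩
  Z (Vec.toList L) (at (λ a → (+ a) ^ r) k) ∎

+-count : ∀ n m k → + count {suc n} m k ≡
  ∑[ σ ← perms (suc n) ] (if pred (length (cycles σ)) ≡ᵇ m
                          then Z (sizes (cycles σ)) (at (λ a → (+ a) ^ m) k) else 0ℤ)
+-count n m k = begin
  + count {suc n} m k
    ≡⟨ ∑-filter (ofType? m k) (admissible {suc n}) ⟩
  ∑[ x ← admissible {suc n} ] (if does (ofType? m k x) then 1ℤ else 0ℤ)
    ≡⟨ ∑-bind _,_ (perms (suc n)) labels _ ⟩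
  ∑[ σ ← perms (suc n) ] ∑[ pw ← labels σ ] (if does (ofType? m k (σ , pw)) then 1ℤ else 0ℤ)
    ≡⟨ ∑-cong (perms (suc n)) (λ σ → trans
         (∑-bind _,_ (lastZero (length (cycles σ))) (λ _ → box (cycleSizes σ)) _)
         (trans (sum-indicators (pred (length (cycles σ))) (cycleSizes σ))
           (cong (λ L → if pred (length (cycles σ)) ≡ᵇ m then Z L (at (λ a → (+ a) ^ m) k) else 0ℤ)
             (toList-cycleSizes σ)))) ⟩
  ∑[ σ ← perms (suc n) ] (if pred (length (cycles σ)) ≡ᵇ m
                          then Z (sizes (cycles σ)) (at (λ a → (+ a) ^ m) k) else 0ℤ) ∎
  where
  -- The condition is what `does (ofType? m k _)` computes to, both cycle counts being successors.
  sum-indicators : ∀ r (L : Vec ℕ (suc r)) →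
    ∑[ p ← lastZero (suc r) ] ∑[ w ← box L ] (if (r ≡ᵇ m) ∧ (k ≡ᵇ Vec.sum w ℕ.+ des p) then 1ℤ else 0ℤ) ≡
    (if r ≡ᵇ m then Z (Vec.toList L) (at (λ a → (+ a) ^ m) k) else 0ℤ)
  sum-indicators r L with r ≡ᵇ m in r≡ᵇm
  ... | false = trans (∑-cong (lastZero (suc r)) (λ p → ∑-0 (box L))) (∑-0 (lastZero (suc r)))
  ... | true with ℕ.≡ᵇ⇒≡ r m (subst Bool.T (sym r≡ᵇm) _)
  ... | refl = trans
    (∑-cong (lastZero (suc r)) (λ p → ∑-cong (box L) (λ w → sym (at-δ₀ k (Vec.sum w ℕ.+ des p)))))
    (∑-labels L k)

∑-select : ∀ n s (F : ℕ → ℤ) → s < n → ∑[ m ← upTo n ] (if s ≡ᵇ m then F m else 0ℤ) ≡ F s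
∑-select (suc n) zero F _ = begin
  ∑[ m ← upTo (suc n) ] (if 0 ≡ᵇ m then F m else 0ℤ) ≡⟨ ∑-upTo n (λ m → if 0 ≡ᵇ m then F m else 0ℤ) ⟩
  F 0 + ∑[ m ← upTo n ] 0ℤ                           ≡⟨ +-congˡ (F 0) (∑-0 (upTo n)) ⟩
  F 0 + 0ℤ                                           ≡⟨ ℤ.+-identityʳ _ ⟩
  F 0                                                ∎
∑-select (suc n) (suc s) F (s≤s s<n) = begin
  ∑[ m ← upTo (suc n) ] (if suc s ≡ᵇ m then F m else 0ℤ)     ≡⟨ ∑-upTo n (λ m → if suc s ≡ᵇ m then F m else 0ℤ) ⟩
  0ℤ + ∑[ m ← upTo n ] (if s ≡ᵇ m then F (suc m) else 0ℤ)    ≡⟨ ℤ.+-identityˡ _ ⟩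
  ∑[ m ← upTo n ] (if s ≡ᵇ m then F (suc m) else 0ℤ)         ≡⟨ ∑-select n s (F ∘ suc) s<n ⟩
  F (suc s)                                                  ∎

-- Separates the cut-off from the argument, which may then be a negative integer. This is the shape
-- that `weigh` requires.
at-scale : ∀ (h : ℤ → ℤ) k b → at (λ a → h (+ a)) k b ≡ at (λ _ → 1ℤ) k b * h (+ k - + b)
at-scale h k       zero    = trans (sym (ℤ.*-identityˡ (h (+ k)))) (cong (λ z → 1ℤ * h z) (sym (ℤ.+-identityʳ (+ k))))
at-scale h zero    (suc b) = refl
at-scale h (suc k) (suc b) = trans (at-scale h k b)
  (cong (λ z → at (λ _ → 1ℤ) k b * h z) (lemma (+ k) (+ b)))
  where
  lemma : ∀ k b → k - b ≡ (1ℤ + k) - (1ℤ + b)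
  lemma = solve-∀

^-distribʳ-* : ∀ a b r → (a * b) ^ r ≡ a ^ r * b ^ r
^-distribʳ-* a b zero    = refl
^-distribʳ-* a b (suc r) = trans (cong (a * b *_) (^-distribʳ-* a b r)) (lemma a b (a ^ r) (b ^ r))
  where
  lemma : ∀ a b x y → a * b * (x * y) ≡ a * x * (b * y)
  lemma = solve-∀

-- The factor t^m turns a^m into (a t)^m. Each permutation has a single m, one less than its number
-- of cycles, so the sum over m becomes a sum of `ζ` over all permutations, and `∑-perms` meets
-- `∑-box-δ₀`.
∑-count : ∀ n k t → k ≤ n →
  ∑[ m ← upTo (suc n) ] ((+ t) ^ m * + count {suc n} m k) ≡
  + (n !) * ∑[ w ← box (replicate (suc n) (suc t)) ] at δ₀ (k ℕ.* t) (Vec.sum w)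
∑-count n k t k≤n = begin
  ∑[ m ← upTo (suc n) ] ((+ t) ^ m * + count {suc n} m k)
    ≡⟨ ∑-cong (upTo (suc n)) (λ m → trans (cong ((+ t) ^ m *_) (+-count n m k))
         (sym (∑-*ˡ (perms (suc n)) ((+ t) ^ m) _))) ⟩
  ∑[ m ← upTo (suc n) ] ∑[ σ ← perms (suc n) ] ((+ t) ^ m * (if r′ σ ≡ᵇ m then X σ m else 0ℤ))
    ≡⟨ ∑-swap (upTo (suc n)) (perms (suc n)) (λ m σ → (+ t) ^ m * (if r′ σ ≡ᵇ m then X σ m else 0ℤ)) ⟩
  ∑[ σ ← perms (suc n) ] ∑[ m ← upTo (suc n) ] ((+ t) ^ m * (if r′ σ ≡ᵇ m then X σ m else 0ℤ))
    ≡⟨ ∑-cong (perms (suc n)) (λ σ → trans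
         (∑-cong (upTo (suc n)) (λ m → if-* (r′ σ ≡ᵇ m) ((+ t) ^ m) (X σ m)))
         (∑-select (suc n) (r′ σ) (λ m → (+ t) ^ m * X σ m) (r′< σ))) ⟩
  ∑[ σ ← perms (suc n) ] ((+ t) ^ r′ σ * X σ (r′ σ))
    ≡⟨ ∑-cong (perms (suc n)) (λ σ → trans (scale (sizes (cycles σ)) (r′ σ))
         (cong (λ s → Z (sizes (cycles σ)) (weigh u v (pred s))) (sym (List.length-map ∣_∣ (cycles σ))))) ⟩
  ∑[ σ ← perms (suc n) ] ζ u v (sizes (cycles σ))
    ≡⟨ ∑-perms n u v ⟩
  D (suc n) (λ j → u j * rising n (v j - + j))
    ≡⟨ D-cong (suc n) (λ j → sym (trans
         (at-cong (λ a → cong (λ z → rising n (z - + j)) (ℤ.pos-* a t)) k j)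
         (at-scale (λ z → rising n (z * + t - + j)) k j))) ⟩
  D (suc n) (λ j → at (λ a → rising n (+ (a ℕ.* t) - + j)) k j)
    ≡⟨ sym (∑-box-δ₀ n k t k≤n) ⟩
  + (n !) * ∑[ w ← box (replicate (suc n) (suc t)) ] at δ₀ (k ℕ.* t) (Vec.sum w) ∎
  where
  r′ : Vec (Fin (suc n)) (suc n) → ℕ
  r′ σ = pred (length (cycles σ))
  X : Vec (Fin (suc n)) (suc n) → ℕ → ℤ
  X σ m = Z (sizes (cycles σ)) (at (λ a → (+ a) ^ m) k)
  u v : ℕ → ℤ
  u b = at (λ _ → 1ℤ) k b
  v b = (+ k - + b) * + t

  if-* : ∀ b c x → c * (if b then x else 0ℤ) ≡ (if b then c * x else 0ℤ)
  if-* true  c x = refl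
  if-* false c x = ℤ.*-zeroʳ c

  r′< : ∀ σ → r′ σ < suc n
  -- There are at most n + 1 cycles, so the m that belongs to `σ` is in the range of summation.
  r′< σ = s≤s (ℕ.≤-trans (ℕ.pred-mono-≤ (ℕ.≤-trans
    (List.length-deduplicate (Vec.≡-dec Bool._≟_) (List.map (orbit σ) (allFin (suc n))))
    (ℕ.≤-reflexive (trans (List.length-map (orbit σ) (allFin (suc n))) (List.length-tabulate {n = suc n} id))))) ℕ.≤-refl)

  scale : ∀ L r → (+ t) ^ r * Z L (at (λ a → (+ a) ^ r) k) ≡ Z L (weigh u v r)
  scale L r = trans (sym (Z-*ˡ L ((+ t) ^ r) _)) (Z-cong L (λ b → trans
    (cong ((+ t) ^ r *_) (at-scale (_^ r) k b))
    (trans (lemma ((+ t) ^ r) (u b) ((+ k - + b) ^ r)) (cong (u b *_) (sym (^-distribʳ-* (+ k - + b) (+ t) r))))))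
    where
    lemma : ∀ a b c → a * (b * c) ≡ b * (c * a)
    lemma = solve-∀

-- Lattice points of the dilated hypersimplex

fromℕ-homo-+ : ∀ a b → fromℕ (a ℕ.+ b) ≡ fromℕ a ℚ.+ fromℕ b
fromℕ-homo-+ a b = trans (cong fromℤ (ℤ.pos-+ a b)) (fromℤ-homo-+ (+ a) (+ b))

fromℕ-homo-* : ∀ a b → fromℕ (a ℕ.* b) ≡ fromℕ a ℚ.* fromℕ b
fromℕ-homo-* a b = trans (cong fromℤ (ℤ.pos-* a b)) (fromℤ-homo-* (+ a) (+ b))

integral : ∀ {n} → Vec ℕ n → Vec ℤ n
integral = Vec.map (λ a → + a)

module _ (k t : ℕ) .{{t≢0 : ℕ.NonZero t}} where

  private
    T = fromℕ t

    instance
      T-pos : ℚ.Positive T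
      T-pos = ℚ.normalize-pos t 1

      T-nonNeg : ℚ.NonNegative T
      T-nonNeg = ℚ.pos⇒nonNeg T

      T-nonZero : ℚ.NonZero T
      T-nonZero = ℚ.pos⇒nonZero T

    s = 1/ T

    instance
      s-nonNeg : ℚ.NonNegative s
      s-nonNeg = ℚ.pos⇒nonNeg s {{ℚ.1/pos⇒pos T}}

    -- Division by t: the point of the hypersimplex whose dilate is the given lattice point.
    scaled : ∀ {n} → Vec ℕ n → Point n
    scaled = Vec.map (λ a → fromℕ a ℚ.* s)

    Bounded : ∀ {n} → Pred (Vec ℕ n) 0ℓ
    Bounded {n} w = ∀ i → lookup w i < lookup (replicate n (suc t)) i

    InUnit : Pred ℚ 0ℓ
    InUnit x = 0ℚ ℚ.≤ x × x ℚ.≤ 1ℚ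

    scaled-inUnit : ∀ {n} (w : Vec ℕ n) → Bounded w → VecAll.All InUnit (scaled w)
    scaled-inUnit []      _       = []
    scaled-inUnit (a ∷ w) bounded = (lower , upper) ∷ scaled-inUnit w (bounded ∘ suc)
      where
      lower : 0ℚ ℚ.≤ fromℕ a ℚ.* s
      lower = subst (ℚ._≤ fromℕ a ℚ.* s) (ℚ.*-zeroˡ s)
        (ℚ.*-monoʳ-≤-nonNeg s (fromℤ-mono-≤ {+ 0} {+ a} (+≤+ z≤n)))
      upper : fromℕ a ℚ.* s ℚ.≤ 1ℚ
      upper = subst (fromℕ a ℚ.* s ℚ.≤_) (ℚ.*-inverseʳ T)
        (ℚ.*-monoʳ-≤-nonNeg s (fromℤ-mono-≤ (+≤+ (ℕ.s≤s⁻¹ (bounded zero)))))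

    sum-scaled : ∀ {n} (w : Vec ℕ n) → Vec.foldr′ ℚ._+_ 0ℚ (scaled w) ≡ fromℕ (Vec.sum w) ℚ.* s
    sum-scaled []      = sym (ℚ.*-zeroˡ s)
    sum-scaled (a ∷ w) = begin
      fromℕ a ℚ.* s ℚ.+ Vec.foldr′ ℚ._+_ 0ℚ (scaled w) ≡⟨ cong (fromℕ a ℚ.* s ℚ.+_) (sum-scaled w) ⟩
      fromℕ a ℚ.* s ℚ.+ fromℕ (Vec.sum w) ℚ.* s        ≡⟨ sym (ℚ.*-distribʳ-+ s (fromℕ a) _) ⟩
      (fromℕ a ℚ.+ fromℕ (Vec.sum w)) ℚ.* s            ≡⟨ cong (ℚ._* s) (sym (fromℕ-homo-+ a (Vec.sum w))) ⟩
      fromℕ (Vec.sum (a ∷ w)) ℚ.* s                    ∎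

    rescale : ∀ a → T ℚ.* (fromℕ a ℚ.* s) ≡ fromℕ a
    rescale a = begin
      T ℚ.* (fromℕ a ℚ.* s)   ≡⟨ cong (T ℚ.*_) (ℚ.*-comm (fromℕ a) s) ⟩
      T ℚ.* (s ℚ.* fromℕ a)   ≡⟨ sym (ℚ.*-assoc T s (fromℕ a)) ⟩
      T ℚ.* s ℚ.* fromℕ a     ≡⟨ cong (ℚ._* fromℕ a) (ℚ.*-inverseʳ T) ⟩
      1ℚ ℚ.* fromℕ a          ≡⟨ ℚ.*-identityˡ (fromℕ a) ⟩
      fromℕ a                 ∎

    sound : ∀ {n} {w : Vec ℕ n} → Bounded w × k ℕ.* t ≡ Vec.sum w →
            LatticePoint (dilate T (Hypersimplex k n)) (integral w)
    sound {w = w} (bounded , kt≡) = scaled w , (scaled-inUnit w bounded , sum≡k) , (begin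
      Vec.map fromℤ (integral w)   ≡⟨ sym (Vec.map-∘ fromℤ (λ a → + a) w) ⟩
      Vec.map fromℕ w                ≡⟨ Vec.map-cong (λ a → sym (rescale a)) w ⟩
      Vec.map (λ a → T ℚ.* (fromℕ a ℚ.* s)) w ≡⟨ Vec.map-∘ (T ℚ.*_) (λ a → fromℕ a ℚ.* s) w ⟩
      Vec.map (T ℚ.*_) (scaled w)    ∎)
      where
      sum≡k : Vec.foldr′ ℚ._+_ 0ℚ (scaled w) ≡ fromℕ k
      sum≡k = begin
        Vec.foldr′ ℚ._+_ 0ℚ (scaled w)  ≡⟨ sum-scaled w ⟩
        fromℕ (Vec.sum w) ℚ.* s         ≡⟨ cong (λ a → fromℕ a ℚ.* s) (sym kt≡) ⟩
        fromℕ (k ℕ.* t) ℚ.* s           ≡⟨ cong (ℚ._* s) (fromℕ-homo-* k t) ⟩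
        fromℕ k ℚ.* T ℚ.* s             ≡⟨ ℚ.*-assoc (fromℕ k) T s ⟩
        fromℕ k ℚ.* (T ℚ.* s)           ≡⟨ cong (fromℕ k ℚ.*_) (ℚ.*-inverseʳ T) ⟩
        fromℕ k ℚ.* 1ℚ                  ≡⟨ ℚ.*-identityʳ (fromℕ k) ⟩
        fromℕ k                         ∎

    natural : ∀ {z} → + 0 ℤ.≤ z → z ℤ.≤ + t → ∃[ a ] a < suc t × + a ≡ z
    natural {+ a} _ a≤t = a , s≤s (ℤ.drop‿+≤+ a≤t) , refl

    -- Multiplying 0 ≤ x ≤ 1 by t > 0 confines the integer to 0, ..., t.
    complete-entry : ∀ {z x} → InUnit x → fromℤ z ≡ T ℚ.* x → ∃[ a ] a < suc t × + a ≡ z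
    complete-entry {z} {x} (0≤x , x≤1) z≡Tx = natural
      (fromℤ-cancel-≤ (subst₂ ℚ._≤_ (ℚ.*-zeroʳ T) (sym z≡Tx) (ℚ.*-monoˡ-≤-nonNeg T 0≤x)))
      (fromℤ-cancel-≤ (subst₂ ℚ._≤_ (sym z≡Tx) (ℚ.*-identityʳ T) (ℚ.*-monoˡ-≤-nonNeg T x≤1)))

    complete-vec : ∀ {n} (z : Vec ℤ n) x → VecAll.All InUnit x → Vec.map fromℤ z ≡ Vec.map (T ℚ.*_) x →
                   ∃[ w ] Bounded w × integral w ≡ z × fromℕ (Vec.sum w) ≡ T ℚ.* Vec.foldr′ ℚ._+_ 0ℚ x
    complete-vec []      []      []           _  = [] , (λ ()) , refl , sym (ℚ.*-zeroʳ T)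
    complete-vec (z ∷ zs) (x ∷ xs) (x∈ ∷ xs∈) eq
      with complete-entry {z} x∈ (Vec.∷-injectiveˡ eq) | complete-vec zs xs xs∈ (Vec.∷-injectiveʳ eq)
    ... | a , a≤t , refl | w , bounded , refl , sum≡ =
      a ∷ w , (λ { zero → a≤t ; (suc i) → bounded i }) , refl , (begin
        fromℕ (a ℕ.+ Vec.sum w)                          ≡⟨ fromℕ-homo-+ a (Vec.sum w) ⟩
        fromℕ a ℚ.+ fromℕ (Vec.sum w)                    ≡⟨ cong₂ ℚ._+_ (Vec.∷-injectiveˡ eq) sum≡ ⟩
        T ℚ.* x ℚ.+ T ℚ.* Vec.foldr′ ℚ._+_ 0ℚ xs         ≡⟨ sym (ℚ.*-distribˡ-+ T x _) ⟩
        T ℚ.* Vec.foldr′ ℚ._+_ 0ℚ (x ∷ xs)               ∎)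

    complete : ∀ {n} {z : Vec ℤ n} → LatticePoint (dilate T (Hypersimplex k n)) z →
               ∃[ w ] (Bounded w × k ℕ.* t ≡ Vec.sum w) × integral w ≡ z
    complete {z = z} (x , (x∈ , sum≡k) , eq) with complete-vec z x x∈ eq
    ... | w , bounded , w≡z , sum≡ = w , (bounded , fromℕ-injective (begin
      fromℕ (k ℕ.* t)                      ≡⟨ fromℕ-homo-* k t ⟩
      fromℕ k ℚ.* T                        ≡⟨ ℚ.*-comm (fromℕ k) T ⟩
      T ℚ.* fromℕ k                        ≡⟨ cong (T ℚ.*_) (sym sum≡k) ⟩
      T ℚ.* Vec.foldr′ ℚ._+_ 0ℚ x          ≡⟨ sym sum≡ ⟩
      fromℕ (Vec.sum w)                    ∎)) , w≡z

    integral-injective : ∀ {n} {v w : Vec ℕ n} → integral v ≡ integral w → v ≡ w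
    integral-injective {v = []}    {[]}    _  = refl
    integral-injective {v = a ∷ v} {b ∷ w} eq =
      cong₂ _∷_ (ℤ.+-injective (Vec.∷-injectiveˡ eq)) (integral-injective (Vec.∷-injectiveʳ eq))

  latticePoints : ∀ n → List (Vec ℕ n)
  latticePoints n = filter (λ w → k ℕ.* t ℕ.≟ Vec.sum w) (box (replicate n (suc t)))

  cardinality-latticePoints : ∀ n → HasCardinality (LatticePoint (dilate (fromℕ t) (Hypersimplex k n)))
                                                   (length (latticePoints n))
  cardinality-latticePoints n = subst (HasCardinality _) (List.length-map integral (latticePoints n))
    (enumerates⇒cardinality (enumerates-map integral integral-injective
      (enumerates-filter (λ w → k ℕ.* t ℕ.≟ Vec.sum w) (enumerates-box (replicate n (suc t))))
      sound complete))

  +-latticePoints : ∀ n → + length (latticePoints n) ≡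
                    ∑[ w ← box (replicate n (suc t)) ] at δ₀ (k ℕ.* t) (Vec.sum w)
  +-latticePoints n = trans (∑-filter (λ w → k ℕ.* t ℕ.≟ Vec.sum w) (box (replicate n (suc t))))
    (∑-cong (box (replicate n (suc t))) (λ w → sym (at-δ₀ (k ℕ.* t) (Vec.sum w))))

-- Comparison with the Ehrhart polynomial

countPolynomial : ℕ → ℕ → Polynomial
countPolynomial n k = applyUpTo (λ m → fromℕ (count {suc n} m k)) (suc n)

eval-countPolynomial : ∀ n k t .{{_ : ℕ.NonZero t}} → k ≤ n →
  eval (countPolynomial n k) (fromℕ t) ≡ fromℕ (n !) ℚ.* fromℕ (length (latticePoints k t (suc n)))
eval-countPolynomial n k t k≤n = begin
  eval (countPolynomial n k) (fromℕ t)
    ≡⟨ eval-applyUpTo (λ m → + count {suc n} m k) (suc n) (+ t) ⟩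
  fromℤ (∑[ m ← upTo (suc n) ] ((+ t) ℤ.^ m ℤ.* + count {suc n} m k))
    ≡⟨ cong fromℤ (trans (∑-count n k t k≤n) (cong (+ (n !) ℤ.*_) (sym (+-latticePoints k t (suc n))))) ⟩
  fromℤ (+ (n !) ℤ.* + length (latticePoints k t (suc n)))
    ≡⟨ fromℤ-homo-* (+ (n !)) _ ⟩
  fromℕ (n !) ℚ.* fromℕ (length (latticePoints k t (suc n))) ∎

ehrhartPolynomial-exists : ∀ n k → k ≤ n → ∃[ ehr ] IsEhrhartPolynomial (Hypersimplex k (suc n)) ehr
ehrhartPolynomial-exists n k k≤n = 1/n! · countPolynomial n k , λ t →
  length (latticePoints k t (suc n)) , cardinality-latticePoints k t (suc n) , (begin
    eval (1/n! · countPolynomial n k) (fromℕ t)       ≡⟨ eval-· 1/n! (countPolynomial n k) (fromℕ t) ⟩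
    1/n! ℚ.* eval (countPolynomial n k) (fromℕ t)     ≡⟨ cong (1/n! ℚ.*_) (eval-countPolynomial n k t k≤n) ⟩
    1/n! ℚ.* (fromℕ (n !) ℚ.* N t)                    ≡⟨ sym (ℚ.*-assoc 1/n! (fromℕ (n !)) (N t)) ⟩
    1/n! ℚ.* fromℕ (n !) ℚ.* N t                      ≡⟨ cong (ℚ._* N t) (ℚ.*-inverseˡ (fromℕ (n !)) {{n!-nonZero}}) ⟩
    1ℚ ℚ.* N t                                        ≡⟨ ℚ.*-identityˡ (N t) ⟩
    N t                                               ∎)
  where
  n!-nonZero : ℚ.NonZero (fromℕ (n !))
  n!-nonZero = fromℕ-nonZero (n !) {{n ℕ.!≢0}}
  1/n! = (1/ fromℕ (n !)) {{n!-nonZero}}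
  N : ∀ t .{{_ : ℕ.NonZero t}} → ℚ
  N t = fromℕ (length (latticePoints k t (suc n)))

-- Both polynomials are n! times the number of lattice points at every positive integer, and that
-- number does not depend on the enumeration, so their coefficients agree.
coeff-ehrhartPolynomial : ∀ n k → k ≤ n → ∀ ehr → IsEhrhartPolynomial (Hypersimplex k (suc n)) ehr →
  ∀ m → m ≤ n → coeff (fromℕ (n !) · ehr) m ≡ fromℕ (count {suc n} m k)
coeff-ehrhartPolynomial n k k≤n ehr isEhr m m≤n = trans
  (eval-injective (fromℕ (n !) · ehr) (countPolynomial n k) agree m)
  (coeff-applyUpTo (λ m → fromℕ (count {suc n} m k)) (s≤s m≤n))
  where
  agree : ∀ t .{{_ : ℕ.NonZero t}} → eval (fromℕ (n !) · ehr) (fromℕ t) ≡ eval (countPolynomial n k) (fromℕ t)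
  agree t = let N , N-card , eval≡N = isEhr t in begin
    eval (fromℕ (n !) · ehr) (fromℕ t)                        ≡⟨ eval-· (fromℕ (n !)) ehr (fromℕ t) ⟩
    fromℕ (n !) ℚ.* eval ehr (fromℕ t)                        ≡⟨ cong (fromℕ (n !) ℚ.*_) eval≡N ⟩
    fromℕ (n !) ℚ.* fromℕ N                                   ≡⟨ cong (λ N → fromℕ (n !) ℚ.* fromℕ N)
                                                                   (cardinality-unique N-card (cardinality-latticePoints k t (suc n))) ⟩
    fromℕ (n !) ℚ.* fromℕ (length (latticePoints k t (suc n))) ≡⟨ sym (eval-countPolynomial n k t k≤n) ⟩
    eval (countPolynomial n k) (fromℕ t)                      ∎

theorem2p2 : (n k : ℕ) → 2 ≤ n → 1 ≤ k → k ≤ n ∸ 1 →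
    (∃[ ehr ] IsEhrhartPolynomial (Hypersimplex k n) ehr) ×
    (∀ (ehr : Polynomial) → IsEhrhartPolynomial (Hypersimplex k n) ehr →
    ∀ (m : ℕ) → m ≤ n ∸ 1 →
    ∃[ N ] HasCardinality (Compatible (replicate n 1) ∩ HasType n (suc m) k) N ×
    coeff (fromℕ ((n ∸ 1) !) · ehr) m ≡ fromℕ N)
theorem2p2 (suc n) k _ _ k≤n = ehrhartPolynomial-exists n k k≤n , λ ehr isEhr m m≤n →
  count {suc n} m k , cardinality-count m k , coeff-ehrhartPolynomial n k k≤n ehr isEhr m m≤n
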